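{- Let $(\mathbf A,\exists)$ be a monadic Pavelka algebra with $\mathbf A$ semisimple, and let $\forall(x)=\neg\exists(\neg x)$. The following are equivalent: (i) the relation $R\colon\mathrm{Spec_M}\mathbf A\times\mathrm{Spec_M}\mathbf A\to[0,1]$, $R(F,F')=\bigwedge_{a\in A}(\forall(a)/F'\rightarrow a/F)$, is $\{0,1\}$-valued (i.e. $(\mathbf A,\exists)$ is induced by a boolean equivalence); (ii) $(\mathbf A,\exists)$ is a monadic Pavelka algebra in the original sense, i.e. for all $x,y\in A$ and all constants $\mathbf r$: $x\le\exists x$; $\exists(x\vee y)=\exists x\vee\exists y$; $\exists(\neg\exists x)=\neg\exists x$; $\exists(\exists x\oplus\exists y)=\exists x\oplus\exists y$; $\exists(x\oplus x)=\exists x\oplus\exists x$; $\exists(x\cdot x)=\exists x\cdot\exists x$; and $\exists\mathbf r=\mathbf r$; (iii) $\forall(x)\cdot\forall(y)\le\forall(x\cdot y)$ for all $x,y\in A$.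
   Context: An MV-algebra $(A;\oplus,\neg,0)$ carries derived operations $1=\neg0$, $x\cdot y=\neg(\neg x\oplus\neg y)$, $x\rightarrow y=\neg x\oplus y$, $x\vee y=\neg(\neg x\oplus y)\oplus y$, $x\wedge y=\neg(\neg x\vee\neg y)$, order $x\le y$ iff $\neg x\oplus y=1$. The standard MV-algebra is $[0,1]$ with $x\oplus y=\min\{x+y,1\}$, $\neg x=1-x$. A Pavelka algebra is $\mathbf A=(A;\oplus,\neg,\{\mathbf r\mid r\in[0,1]\cap\mathbb Q\})$ with $(A;\oplus,\neg,\mathbf 0)$ an MV-algebra, $\mathbf r\oplus\mathbf s=\mathbf t$ whenever $\min\{r+s,1\}=t$, $\neg\mathbf r=\mathbf s$ whenever $1-r=s$. Filters are filters of the MV-reduct; $\mathrm{Spec_M}\mathbf A$ is the set of maximal proper filters; for $F\in\mathrm{Spec_M}\mathbf A$, $\mathbf A/F$ embeds uniquely into $[0,1]$ and $x/F$ is identified with its image. Semisimple: MV-reduct is a subdirect product of simple MV-algebras. A monadic Pavelka algebra is $(\mathbf A,\exists)$ with $\exists$ a closure operator (monotone, $x\le\exists x$, $\exists\exists x=\exists x$) such that $\exists(\neg\exists(x))=\neg\exists(x)$ and $\mathbf r\cdot\exists(x)=\exists(\mathbf r\cdot x)$ for all $x$ and constants $\mathbf r$. -}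

module Defs where

open import Algebra.Core using (Op₁; Op₂)
open import Algebra.Structures using (IsCommutativeMonoid)
open import Data.Product using (∃; ∃₂; _×_; _,_)
open import Data.Rational as ℚ using (ℚ; 0ℚ; 1ℚ)
import Data.Rational.Properties as ℚ
open import Data.Sum using (_⊎_)
open import Function.Definitions using (Congruent; Injective; Surjective)
open import Level using (Level; Lift; suc; _⊔_)
open import Relation.Binary.Bundles using (Poset)
open import Relation.Binary.Core using (Rel)
open import Relation.Binary.PropositionalEquality using (_≡_)
open import Relation.Binary.Structures using (IsEquivalence)
open import Relation.Nullary using () renaming (¬_ to Not)
open import Relation.Unary using (Pred; _⊆_; _∈_; _∉_)

private
  variable
    a c ℓ e ℓ₁ ℓ₂ : Level

-- Zorn's lemma: if every chain has an upper bound, there is a maximal element.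
-- The empty chain is included, so the poset is required to be inhabited.

Zorn : ∀ c ℓ₁ ℓ₂ → Set (suc (c ⊔ ℓ₁ ⊔ ℓ₂))
Zorn c ℓ₁ ℓ₂ = (P : Poset c ℓ₁ ℓ₂) → let open Poset P in
  ((C : Pred Carrier c) →
     (∀ {x y} → x ∈ C → y ∈ C → (x ≤ y) ⊎ (y ≤ x)) →
     ∃ λ u → ∀ {x} → x ∈ C → x ≤ u) →
  ∃ λ m → ∀ {x} → m ≤ x → x ≤ m

------------------------------------------------------------------------
-- MV-algebras

record RawMV c ℓ : Set (suc (c ⊔ ℓ)) where
  infix  4 _≈_ _≤_
  infixr 5 _⇒_
  infixl 6 _⊕_ _∨_
  infixl 7 _·_ _∧_
  infix  8 ¬_
  field
    Carrier : Set c
    _≈_     : Rel Carrier ℓ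
    _⊕_     : Op₂ Carrier
    ¬_      : Op₁ Carrier
    0#      : Carrier

  1# : Carrier
  1# = ¬ 0#

  _·_ _⇒_ _∨_ _∧_ : Op₂ Carrier
  x · y = ¬ (¬ x ⊕ ¬ y)
  x ⇒ y = ¬ x ⊕ y
  x ∨ y = ¬ (¬ x ⊕ y) ⊕ y
  x ∧ y = ¬ (¬ x ∨ ¬ y)

  _≤_ : Rel Carrier ℓ
  x ≤ y = ¬ x ⊕ y ≈ 1#

record IsMV (M : RawMV c ℓ) : Set (c ⊔ ℓ) where
  open RawMV M
  field
    isCommutativeMonoid : IsCommutativeMonoid _≈_ _⊕_ 0#
    ¬-cong              : Congruent _≈_ _≈_ ¬_
    ¬-involutive        : ∀ x → ¬ ¬ x ≈ x
    ⊕-zeroʳ             : ∀ x → x ⊕ ¬ 0# ≈ ¬ 0#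
    łukasiewicz         : ∀ x y → ¬ (¬ x ⊕ y) ⊕ y ≈ ¬ (¬ y ⊕ x) ⊕ x

record IsMVHomomorphism (M : RawMV c ℓ₁) (N : RawMV e ℓ₂)
                        (h : RawMV.Carrier M → RawMV.Carrier N) :
                        Set (c ⊔ ℓ₁ ⊔ ℓ₂) where
  private
    module M = RawMV M
    module N = RawMV N
  field
    cong   : Congruent M._≈_ N._≈_ h
    ⊕-homo : ∀ x y → h (x M.⊕ y) N.≈ h x N.⊕ h y
    ¬-homo : ∀ x → h (M.¬ x) N.≈ N.¬ h x
    0-homo : h M.0# N.≈ N.0#

record IsCongruence (M : RawMV c ℓ) (_θ_ : Rel (RawMV.Carrier M) ℓ) :
                    Set (c ⊔ ℓ) where
  open RawMV M
  field
    isEquivalence : IsEquivalence _θ_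
    reflexive     : ∀ {x y} → x ≈ y → x θ y
    ⊕-compatible  : ∀ {x y u v} → x θ y → u θ v → (x ⊕ u) θ (y ⊕ v)
    ¬-compatible  : ∀ {x y} → x θ y → (¬ x) θ (¬ y)

record IsSimple (M : RawMV c ℓ) : Set (c ⊔ suc ℓ) where
  open RawMV M
  field
    nontrivial  : Not (0# ≈ 1#)
    congruences : (_θ_ : Rel Carrier ℓ) → IsCongruence M _θ_ →
                  (∀ {x y} → x θ y → x ≈ y) ⊎ (∀ x y → x θ y)

-- A subdirect embedding into a product, given by its coordinates: each is
-- onto, and jointly they are injective.  The index set may be empty, so the
-- one-element algebra is semisimple.

record Semisimple (M : RawMV ℓ ℓ) : Set (suc ℓ) where
  open RawMV M
  field
    Index      : Set ℓ
    factor     : Index → RawMV ℓ ℓ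
    isMV       : ∀ i → IsMV (factor i)
    isSimple   : ∀ i → IsSimple (factor i)
    π          : ∀ i → Carrier → RawMV.Carrier (factor i)
    π-homo     : ∀ i → IsMVHomomorphism M (factor i) (π i)
    surjective : ∀ i → Surjective _≈_ (RawMV._≈_ (factor i)) (π i)
    injective  : ∀ {x y} →
                 (∀ i → RawMV._≈_ (factor i) (π i x) (π i y)) → x ≈ y

module _ (M : RawMV c ℓ) where
  open RawMV M

  record IsFilter (F : Pred Carrier a) : Set (c ⊔ ℓ ⊔ a) where
    field
      1-closed : 1# ∈ F
      ·-closed : ∀ {x y} → x ∈ F → y ∈ F → x · y ∈ F
      upward   : ∀ {x y} → x ≤ y → x ∈ F → y ∈ F

  IsProper : Pred (Pred Carrier a) a
  IsProper F = 0# ∉ F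

record Spec (M : RawMV ℓ ℓ) : Set (suc ℓ) where
  field
    filter   : Pred (RawMV.Carrier M) ℓ
    isFilter : IsFilter M filter
    proper   : IsProper M filter
    maximal  : (G : Pred (RawMV.Carrier M) ℓ) → IsFilter M G → IsProper M G →
               filter ⊆ G → G ⊆ filter

------------------------------------------------------------------------
-- Pavelka algebras

record Unitℚ : Set where
  constructor unit
  field
    value : ℚ
    0≤    : 0ℚ ℚ.≤ value
    ≤1    : value ℚ.≤ 1ℚ

open Unitℚ public

0ᵤ : Unitℚ
0ᵤ = unit 0ℚ ℚ.≤-refl (ℚ.nonNegative⁻¹ 1ℚ)

record RawPavelka c ℓ : Set (suc (c ⊔ ℓ)) where
  field
    Carrier : Set c
    _≈_     : Rel Carrier ℓ
    _⊕_     : Op₂ Carrier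
    ¬_      : Op₁ Carrier
    const   : Unitℚ → Carrier

  rawMV : RawMV c ℓ
  rawMV = record { Carrier = Carrier ; _≈_ = _≈_ ; _⊕_ = _⊕_ ; ¬_ = ¬_
                 ; 0# = const 0ᵤ }

  open RawMV rawMV public
    using (0#; 1#; _·_; _⇒_; _∨_; _∧_; _≤_)

record IsPavelka (P : RawPavelka c ℓ) : Set (c ⊔ ℓ) where
  open RawPavelka P
  field
    isMV    : IsMV rawMV
    const-⊕ : ∀ r s t → (value r ℚ.+ value s) ℚ.⊓ 1ℚ ≡ value t →
              (const r ⊕ const s) ≈ const t
    const-¬ : ∀ r s → 1ℚ ℚ.- value r ≡ value s → (¬ const r) ≈ const s

record IsPavelkaEmbedding (P : RawPavelka c ℓ₁) (Q : RawPavelka e ℓ₂)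
                          (h : RawPavelka.Carrier P → RawPavelka.Carrier Q) :
                          Set (c ⊔ ℓ₁ ⊔ ℓ₂) where
  private
    module P = RawPavelka P
    module Q = RawPavelka Q
  field
    isMVHomomorphism : IsMVHomomorphism P.rawMV Q.rawMV h
    const-homo       : ∀ r → h (P.const r) Q.≈ Q.const r
    injective        : Injective P._≈_ Q._≈_ h

-- A/F: the same operations, with equality modulo F.

_/_ : (P : RawPavelka ℓ ℓ) → Spec (RawPavelka.rawMV P) → RawPavelka ℓ ℓ
P / F = record
  { Carrier = Carrier
  ; _≈_     = λ x y → (x ⇒ y) ∈ filter × (y ⇒ x) ∈ filter
  ; _⊕_     = _⊕_
  ; ¬_      = ¬_
  ; const   = const
  } where open RawPavelka P
          open Spec F

------------------------------------------------------------------------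
-- The real unit interval.  A real x ∈ [0,1] is represented by the Dedekind
-- cut {q ∈ [0,1] ∩ ℚ ∣ q ≤ x}.  The one-sided cut is closed on the right
-- (`closed`), so that infima are intersections; 0 ∈ x is `closed` at 0.
-- Under excluded middle these cuts are exactly the reals in [0,1].

record 𝕀 (ℓ : Level) : Set (suc ℓ) where
  field
    cut    : Pred Unitℚ ℓ
    down   : ∀ {p q} → value p ℚ.≤ value q → q ∈ cut → p ∈ cut
    closed : ∀ {q} → (∀ p → value p ℚ.< value q → p ∈ cut) → q ∈ cut

open 𝕀 public using (cut)

-- The supremum in [0,1] of a set of rationals (0 for the empty set).

sup : Pred Unitℚ ℓ → 𝕀 ℓ
sup S = record
  { cut    = λ q → ∀ p → value p ℚ.< value q → ∃ λ s → s ∈ S × value p ℚ.≤ value s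
  ; down   = λ p≤q q∈ r r<p → q∈ r (ℚ.<-≤-trans r<p p≤q)
  ; closed = λ {q} h p p<q →
      let (m , p<m , m<q) = ℚ.<-dense p<q
          mᵤ = unit m (ℚ.≤-trans (0≤ p) (ℚ.<⇒≤ p<m))
                      (ℚ.≤-trans (ℚ.<⇒≤ m<q) (≤1 q))
      in h mᵤ m<q p p<m
  }

inf : {I : Set ℓ} → (I → 𝕀 ℓ) → 𝕀 ℓ
inf f = record
  { cut    = λ q → ∀ i → q ∈ cut (f i)
  ; down   = λ p≤q q∈ i → 𝕀.down (f i) p≤q (q∈ i)
  ; closed = λ h i → 𝕀.closed (f i) λ p p<q → h p p<q i
  }

-- x ⊕ y = min{x + y, 1} is the supremum of min{r + s, 1} over rationals
-- r ≤ x and s ≤ y; ¬ x = 1 - x is the supremum of the rationals t such that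
-- t ≤ 1 - r for all rationals r ≤ x.

standard : ∀ ℓ → RawPavelka (suc ℓ) ℓ
standard ℓ = record
  { Carrier = 𝕀 ℓ
  ; _≈_     = λ x y → cut x ⊆ cut y × cut y ⊆ cut x
  ; _⊕_     = λ x y → sup λ t → ∃₂ λ r s → r ∈ cut x × s ∈ cut y ×
                        value t ≡ (value r ℚ.+ value s) ℚ.⊓ 1ℚ
  ; ¬_      = λ x → sup λ t → ∀ r → r ∈ cut x → value t ℚ.≤ 1ℚ ℚ.- value r
  ; const   = λ r → sup λ t → Lift ℓ (value t ≡ value r)
  }

------------------------------------------------------------------------
-- Monadic Pavelka algebras.  E and A[_] are the quantifiers ∃ and ∀.

module _ (P : RawPavelka c ℓ) where
  open RawPavelka P

  record IsClosureOperator (C : Op₁ Carrier) : Set (c ⊔ ℓ) where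
    field
      monotone   : ∀ {x y} → x ≤ y → C x ≤ C y
      extensive  : ∀ x → x ≤ C x
      idempotent : ∀ x → C (C x) ≈ C x

  record IsMonadic (E : Op₁ Carrier) : Set (c ⊔ ℓ) where
    field
      isClosureOperator : IsClosureOperator E
      E-¬               : ∀ x → E (¬ E x) ≈ (¬ E x)
      E-const           : ∀ r x → (const r · E x) ≈ E (const r · x)

  record IsOriginalMonadic (E : Op₁ Carrier) : Set (c ⊔ ℓ) where
    field
      extensive : ∀ x → x ≤ E x
      E-∨       : ∀ x y → E (x ∨ y) ≈ (E x ∨ E y)
      E-¬       : ∀ x → E (¬ E x) ≈ (¬ E x)
      E-⊕       : ∀ x y → E (E x ⊕ E y) ≈ (E x ⊕ E y)
      E-double  : ∀ x → E (x ⊕ x) ≈ (E x ⊕ E x)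
      E-square  : ∀ x → E (x · x) ≈ (E x · E x)
      E-const   : ∀ r → E (const r) ≈ const r

record MonadicPavelkaAlgebra ℓ : Set (suc ℓ) where
  field
    rawPavelka : RawPavelka ℓ ℓ
    isPavelka  : IsPavelka rawPavelka

  open RawPavelka rawPavelka public

  field
    E         : Op₁ Carrier
    isMonadic : IsMonadic rawPavelka E

  A[_] : Op₁ Carrier
  A[ x ] = ¬ E (¬ x)

  -- The embedding of A/F into [0,1]; it exists and is unique, and `eval` is
  -- a ↦ a/F.

  record Embedding (F : Spec rawMV) : Set (suc ℓ) where
    field
      eval        : Carrier → 𝕀 ℓ
      isEmbedding : IsPavelkaEmbedding (rawPavelka / F) (standard ℓ) eval

  open Embedding public

  private
    module 𝕀ₛ = RawPavelka (standard ℓ)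

  R : {F F′ : Spec rawMV} → Embedding F → Embedding F′ → 𝕀 ℓ
  R i i′ = inf λ a → eval i′ A[ a ] 𝕀ₛ.⇒ eval i a

  IsBooleanValued : Set (suc ℓ)
  IsBooleanValued = (F F′ : Spec rawMV) (i : Embedding F) (i′ : Embedding F′) →
                    (R i i′ 𝕀ₛ.≈ 𝕀ₛ.0#) ⊎ (R i i′ 𝕀ₛ.≈ 𝕀ₛ.1#)

{-# OPTIONS --safe #-}

-- Modulo a maximal filter F the algebra is a chain in which every element is
-- determined by the rational constants below it; this identifies x/F with the
-- cut of the rationals r satisfying (r → x) ∈ F, both for the embedding
-- constructed here and for any other one.  Since ∀ commutes with r → _, it
-- follows that q ≤ R(F,F′) iff (q → b) ∈ F for all b in S = {b ∣ ∀ b ∈ F′}.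
--
-- (i) ⇒ (iii): If (iii) fails at F′ for x and y, pick rationals p ≤ ∀ x/F′,
-- q ≤ ∀ y/F′ and s with ∀(x · y)/F′ < s < p · q.  By prelinearity the
-- elements ((b → x · y) → s), b ∈ S, generate a proper filter, and a maximal F
-- above it has R(F,F′) ≥ 1 - s > 0.  So R(F,F′) = 1, that is S ⊆ F, whence
-- p · q ≤ (x · y)/F ≤ s, a contradiction.
--
-- (iii) ⇒ (i): S is a filter.  If S ⊈ F, then S and F together generate an
-- improper filter, so S contains some s with s/F = 0, and R(F,F′) = 0.
--
-- (iii) ⇒ (ii): The inequalities ∀(x ⊕ x) ≤ ∀ x ⊕ ∀ x and ∀(x · x) ≤ ∀ x · ∀ x
-- are checked at each F′: if t ≤ ∀(x ⊕ x)/F′, then (t → x ⊕ x) ∈ S yields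
-- (t/2 → x) ∈ S; similarly with (1 + t)/2 for the square.

module Submission where

open import Defs
open import Algebra.Structures using (IsCommutativeMonoid)
open import Axiom.ExcludedMiddle using (ExcludedMiddle)
open import Data.Integer.Base as ℤ using (+_; +[1+_])
import Data.Integer.Properties as ℤ
open import Data.Integer.Tactic.RingSolver using (solve-∀)
open import Data.Nat.Base as ℕ using (ℕ)
open import Data.Product using (∃; ∃₂; _×_; _,_; proj₁; proj₂; swap)
open import Data.Rational as ℚ using (ℚ; 0ℚ; 1ℚ; ½; mkℚ)
import Data.Rational.Properties as ℚ
open import Data.Rational.Solver using (module +-*-Solver)
import Data.Rational.Unnormalised as ℚᵘ
import Data.Rational.Unnormalised.Properties as ℚᵘ
import Data.Sum as Sum
open import Data.Sum using (_⊎_; inj₁; inj₂; [_,_]′)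
open import Function.Base using (id)
open import Function.Bundles using (_⇔_; mk⇔)
open import Level using (Lift; lift; lower; suc)
open import Relation.Binary.Bundles using (Poset)
open import Relation.Binary.PropositionalEquality as ≡ using (_≡_)
import Relation.Binary.Reasoning.Setoid as ≈-Reasoning
open import Relation.Nullary using (True; yes; no; contradiction)
  renaming (¬_ to Not)
open import Relation.Nullary.Decidable
  using (toWitness; fromWitness; decidable-stable; toSum; map′)
open import Relation.Unary using (Pred; _∈_; _∉_; _⊆_)

open +-*-Solver using (solve; con; _:=_; _:+_; _:*_; _:-_)

-- Rationals in the unit interval

-- Linear inequalities are reduced to 0 ≤ (a combination of nonnegative terms),
-- the equation being left to the ring solver.

≤-by : ∀ {p q d} → 0ℚ ℚ.≤ d → d ≡ q ℚ.- p → p ℚ.≤ q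
≤-by {p} {q} 0≤d eq = ≡.subst₂ ℚ._≤_ (ℚ.+-identityˡ p)
  (≡.trans (≡.cong (ℚ._+ p) eq) (solve 2 (λ q p → q :- p :+ p := q) ≡.refl q p))
  (ℚ.+-monoˡ-≤ p 0≤d)

<-by : ∀ {p q d} → 0ℚ ℚ.< d → d ≡ q ℚ.- p → p ℚ.< q
<-by {p} {q} 0<d eq = ≡.subst₂ ℚ._<_ (ℚ.+-identityˡ p)
  (≡.trans (≡.cong (ℚ._+ p) eq) (solve 2 (λ q p → q :- p :+ p := q) ≡.refl q p))
  (ℚ.+-monoˡ-< p 0<d)

0≤- : ∀ {p q} → p ℚ.≤ q → 0ℚ ℚ.≤ q ℚ.- p
0≤- {p} {q} p≤q = ≡.subst (ℚ._≤ q ℚ.- p) (ℚ.+-inverseʳ p) (ℚ.+-monoˡ-≤ (ℚ.- p) p≤q)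

0<- : ∀ {p q} → p ℚ.< q → 0ℚ ℚ.< q ℚ.- p
0<- {p} {q} p<q = ≡.subst (ℚ._< q ℚ.- p) (ℚ.+-inverseʳ p) (ℚ.+-monoˡ-< (ℚ.- p) p<q)

0≤+ : ∀ {p q} → 0ℚ ℚ.≤ p → 0ℚ ℚ.≤ q → 0ℚ ℚ.≤ p ℚ.+ q
0≤+ = ℚ.+-mono-≤

-- The Archimedean property of the rationals

multiple : ℕ → ℚ → ℚ
multiple ℕ.zero    δ = 0ℚ
multiple (ℕ.suc n) δ = δ ℚ.+ multiple n δ

toℚᵘ-multiple : ∀ n δ → ℚ.toℚᵘ (multiple n δ) ℚᵘ.≃
                        ℚᵘ.mkℚᵘ (+ n ℤ.* ℚ.numerator δ) (ℚ.denominator-1 δ)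
toℚᵘ-multiple ℕ.zero    δ = ℚᵘ.*≡* ≡.refl
toℚᵘ-multiple (ℕ.suc n) δ@(mkℚ k d _) = ℚᵘ.≃-trans (ℚ.toℚᵘ-homo-+ δ (multiple n δ))
  (ℚᵘ.≃-trans (ℚᵘ.+-congʳ (ℚ.toℚᵘ δ) (toℚᵘ-multiple n δ))
    (ℚᵘ.*≡* (lemma (+ n) k (+ ℕ.suc d))))
  where
  lemma : ∀ n k d → (k ℤ.* d ℤ.+ n ℤ.* k ℤ.* d) ℤ.* d ≡ (+ 1 ℤ.+ n) ℤ.* k ℤ.* (d ℤ.* d)
  lemma = solve-∀

-- As many copies of δ as its denominator add up to its numerator, a positive integer.
archimedean : ∀ {δ} → 0ℚ ℚ.< δ → ∃ λ n → 1ℚ ℚ.≤ multiple n δ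
archimedean {δ@(mkℚ +[1+ k ] d _)} _ = ℕ.suc d , ℚ.toℚᵘ-cancel-≤
  (ℚᵘ.≤-trans (ℚᵘ.*≤* (≡.subst₂ ℤ._≤_ eq₁ eq₂
      (ℤ.*-monoˡ-≤-nonNeg (+ ℕ.suc d) {+ 1} {+[1+ k ]} (ℤ.+≤+ (ℕ.s≤s ℕ.z≤n)))))
    (ℚᵘ.≤-reflexive (ℚᵘ.≃-sym (toℚᵘ-multiple (ℕ.suc d) δ))))
  where
  eq₁ : + ℕ.suc d ℤ.* + 1 ≡ + 1 ℤ.* + ℕ.suc d
  eq₁ = ℤ.*-comm (+ ℕ.suc d) (+ 1)
  eq₂ : + ℕ.suc d ℤ.* +[1+ k ] ≡ (+ ℕ.suc d ℤ.* +[1+ k ]) ℤ.* + 1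
  eq₂ = ≡.sym (ℤ.*-identityʳ _)
archimedean {mkℚ (+ 0) _ _} (ℚ.*<* (ℤ.+<+ ()))
archimedean {mkℚ ℤ.-[1+ _ ] _ _} (ℚ.*<* ())

-- Łukasiewicz arithmetic on rationals

infix  8 ¬ᵘ_
infixl 7 _·ᵘ_
infixl 6 _⊕ᵘ_

1ᵘ : Unitℚ
1ᵘ = unit 1ℚ (ℚ.nonNegative⁻¹ 1ℚ) ℚ.≤-refl

-- Opaque, since conversion checking would otherwise normalise rational arithmetic.
opaque
  _⊕ᵘ_ : Unitℚ → Unitℚ → Unitℚ
  r ⊕ᵘ s = unit ((value r ℚ.+ value s) ℚ.⊓ 1ℚ)
    (ℚ.⊓-glb (0≤+ (0≤ r) (0≤ s)) (ℚ.nonNegative⁻¹ 1ℚ)) (ℚ.p⊓q≤q (value r ℚ.+ value s) 1ℚ)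

  ¬ᵘ_ : Unitℚ → Unitℚ
  ¬ᵘ r = unit (1ℚ ℚ.- value r) (0≤- (≤1 r))
    (≤-by (0≤ r) (solve 1 (λ r → r := con 1ℚ :- (con 1ℚ :- r)) ≡.refl (value r)))

  _·ᵘ_ : Unitℚ → Unitℚ → Unitℚ
  r ·ᵘ s = ¬ᵘ (¬ᵘ r ⊕ᵘ ¬ᵘ s)

  half : Unitℚ → Unitℚ
  half r = unit (½ ℚ.* value r)
    (≡.subst (ℚ._≤ ½ ℚ.* value r) (ℚ.*-zeroʳ ½) (ℚ.*-monoˡ-≤-nonNeg ½ (0≤ r)))
    (ℚ.≤-trans (ℚ.*-monoˡ-≤-nonNeg ½ (≤1 r)) (ℚ.<⇒≤ (ℚ.*<* (ℤ.+<+ (ℕ.s≤s (ℕ.s≤s ℕ.z≤n))))))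

  half+half : ∀ r → value (half r) ℚ.+ value (half r) ≡ value r
  half+half r = solve 1 (λ r → con ½ :* r :+ con ½ :* r := r) ≡.refl (value r)

  half-positive : ∀ r → 0ℚ ℚ.< value r → 0ℚ ℚ.< value (half r)
  half-positive r 0<r = ≡.subst (ℚ._< ½ ℚ.* value r) (ℚ.*-zeroʳ ½) (ℚ.*-monoʳ-<-pos ½ 0<r)

  half⊕half : ∀ r → value (half r ⊕ᵘ half r) ≡ value r
  half⊕half r = ≡.trans (≡.cong (ℚ._⊓ 1ℚ) (half+half r)) (ℚ.p≤q⇒p⊓q≡p (≤1 r))

  -- Its complement 1 - s + r is the value of the Łukasiewicz implication s → r.
  difference : ∀ r s → value r ℚ.≤ value s → Unitℚ
  difference r s r≤s = unit (value s ℚ.- value r) (0≤- r≤s)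
    (≤-by (0≤+ (0≤- (≤1 s)) (0≤ r))
      (solve 2 (λ r s → con 1ℚ :- s :+ r := con 1ℚ :- (s :- r)) ≡.refl (value r) (value s)))

  ⊕ᵘ≤ : ∀ r s → value (r ⊕ᵘ s) ℚ.≤ value r ℚ.+ value s
  ⊕ᵘ≤ r s = ℚ.p⊓q≤p (value r ℚ.+ value s) 1ℚ

  ≤⊕ᵘ : ∀ {p} r s → p ℚ.≤ 1ℚ → p ℚ.≤ value r ℚ.+ value s → p ℚ.≤ value (r ⊕ᵘ s)
  ≤⊕ᵘ r s p≤1 p≤ = ℚ.⊓-glb p≤ p≤1

  ·ᵘ≤ : ∀ {p} r s → 0ℚ ℚ.≤ p → value r ℚ.+ value s ℚ.- 1ℚ ℚ.≤ p → value (r ·ᵘ s) ℚ.≤ p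
  ·ᵘ≤ {p} r s 0≤p ≤p = ≤-by
    (0≤- (≤⊕ᵘ {1ℚ ℚ.- p} (¬ᵘ r) (¬ᵘ s)
      (≤-by 0≤p (solve 1 (λ p → p := con 1ℚ :- (con 1ℚ :- p)) ≡.refl p))
      (≤-by (0≤- ≤p)
        (solve 3 (λ p r s → p :- (r :+ s :- con 1ℚ) :=
                            con 1ℚ :- r :+ (con 1ℚ :- s) :- (con 1ℚ :- p))
           ≡.refl p (value r) (value s)))))
    (solve 2 (λ u p → u :- (con 1ℚ :- p) := p :- (con 1ℚ :- u)) ≡.refl
      (value (¬ᵘ r ⊕ᵘ ¬ᵘ s)) p)

  ≤·ᵘ : ∀ r s → value r ℚ.+ value s ℚ.- 1ℚ ℚ.≤ value (r ·ᵘ s)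
  ≤·ᵘ r s = ≤-by (0≤- (⊕ᵘ≤ (¬ᵘ r) (¬ᵘ s)))
    (solve 3 (λ u r s → con 1ℚ :- r :+ (con 1ℚ :- s) :- u :=
                        con 1ℚ :- u :- (r :+ s :- con 1ℚ))
      ≡.refl (value (¬ᵘ r ⊕ᵘ ¬ᵘ s)) (value r) (value s))

  ·ᵘ≤ˡ : ∀ r s → value (r ·ᵘ s) ℚ.≤ value r
  ·ᵘ≤ˡ r s = ·ᵘ≤ r s (0≤ r) (≤-by (0≤- (≤1 s))
    (solve 2 (λ r s → con 1ℚ :- s := r :- (r :+ s :- con 1ℚ)) ≡.refl (value r) (value s)))

  ≤1·ᵘ : ∀ r → value r ℚ.≤ value (1ᵘ ·ᵘ r)
  ≤1·ᵘ r = ℚ.≤-trans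
    (ℚ.≤-reflexive (solve 1 (λ r → r := con 1ℚ :+ r :- con 1ℚ) ≡.refl (value r))) (≤·ᵘ 1ᵘ r)

  ≤-·ᵘ-¬ᵘ : ∀ q δ → value q ℚ.≤ value (q ·ᵘ ¬ᵘ δ) ℚ.+ value δ
  ≤-·ᵘ-¬ᵘ q δ = ≤-by (0≤- (≤·ᵘ q (¬ᵘ δ)))
    (solve 3 (λ u q d → u :- (q :+ (con 1ℚ :- d) :- con 1ℚ) := u :+ d :- q) ≡.refl
      (value (q ·ᵘ ¬ᵘ δ)) (value q) (value δ))

  ≤+⇒·ᵘ-¬ᵘ≤ : ∀ q δ {m} → 0ℚ ℚ.≤ m → value q ℚ.≤ value δ ℚ.+ m → value (q ·ᵘ ¬ᵘ δ) ℚ.≤ m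
  ≤+⇒·ᵘ-¬ᵘ≤ q δ {m} 0≤m q≤δ+m = ·ᵘ≤ q (¬ᵘ δ) 0≤m
    (≤-by (0≤- q≤δ+m)
      (solve 3 (λ d m q → d :+ m :- q := m :- (q :+ (con 1ℚ :- d) :- con 1ℚ)) ≡.refl
        (value δ) m (value q)))

  ·ᵘ≡¬⊕ : ∀ r s → r ·ᵘ s ≡ ¬ᵘ (¬ᵘ r ⊕ᵘ ¬ᵘ s)
  ·ᵘ≡¬⊕ r s = ≡.refl

  value-⊕ᵘ : ∀ r s → value (r ⊕ᵘ s) ≡ (value r ℚ.+ value s) ℚ.⊓ 1ℚ
  value-⊕ᵘ r s = ≡.refl

  value-¬ᵘ : ∀ r → value (¬ᵘ r) ≡ 1ℚ ℚ.- value r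
  value-¬ᵘ r = ≡.refl

  ¬ᵘ-anti : ∀ r s → value r ℚ.≤ value s → value (¬ᵘ s) ℚ.≤ value (¬ᵘ r)
  ¬ᵘ-anti r s r≤s = ℚ.+-monoʳ-≤ 1ℚ (ℚ.neg-antimono-≤ r≤s)

  difference-positive : ∀ r s r≤s → value r ℚ.< value s → 0ℚ ℚ.< value (difference r s r≤s)
  difference-positive r s _ = 0<-

  -- Residuation read contrapositively, the complement being the implication p → t.
  ¬difference< : ∀ t p q t≤p → value t ℚ.< value (p ·ᵘ q) →
                 value (¬ᵘ difference t p t≤p) ℚ.< value q
  ¬difference< t p q _ t<pq = <-by
    (0<- (ℚ.≰⇒> λ ≤t → ℚ.<-irrefl ≡.refl (ℚ.<-≤-trans t<pq (·ᵘ≤ p q (0≤ t) ≤t))))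
    (solve 3 (λ t p q → p :+ q :- con 1ℚ :- t := q :- (con 1ℚ :- (p :- t))) ≡.refl
      (value t) (value p) (value q))

  -- From 1 - p + t ≤ r + s and r ≤ 1 - p, the term 1 - p cancels.
  ¬difference≤¬⊕ : ∀ t p t≤p r s → value r ℚ.≤ value (¬ᵘ p) →
                   value (¬ᵘ difference t p t≤p) ℚ.≤ value (r ⊕ᵘ s) → value t ℚ.≤ value s
  ¬difference≤¬⊕ t p _ r s r≤ ≤r⊕s = ≤-by (0≤+ (0≤- r≤) (0≤- (ℚ.≤-trans ≤r⊕s (⊕ᵘ≤ r s))))
    (solve 4 (λ t p r s → con 1ℚ :- p :- r :+ (r :+ s :- (con 1ℚ :- (p :- t))) := s :- t)
      ≡.refl (value t) (value p) (value r) (value s))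

  -- 1 - p′ + (p + q - 1) = q - (p′ - p), and p′ exceeds p by at most q - t.
  ≤+difference⇒≤¬⊕· : ∀ t q t≤q p p′ →
                      value p′ ℚ.≤ value p ℚ.+ value (difference t q t≤q) →
                      value t ℚ.≤ value (¬ᵘ p′ ⊕ᵘ p ·ᵘ q)
  ≤+difference⇒≤¬⊕· t q _ p p′ p′≤ = ≤⊕ᵘ (¬ᵘ p′) (p ·ᵘ q) (≤1 t)
    (≤-by (0≤+ (0≤- p′≤) (0≤- (≤·ᵘ p q)))
      (solve 5 (λ t q p p′ u → p :+ (q :- t) :- p′ :+ (u :- (p :+ q :- con 1ℚ))
                  := con 1ℚ :- p′ :+ u :- t) ≡.refl
        (value t) (value q) (value p) (value p′) (value (p ·ᵘ q))))

  ¬ᵘ⊕ᵘ≡1 : ∀ r s → value r ℚ.≤ value s → (value (¬ᵘ r) ℚ.+ value s) ℚ.⊓ 1ℚ ≡ 1ℚ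
  ¬ᵘ⊕ᵘ≡1 r s r≤s = ℚ.p≥q⇒p⊓q≡q (≤-by {1ℚ} {value (¬ᵘ r) ℚ.+ value s} (0≤- r≤s)
    (solve 2 (λ r s → s :- r := con 1ℚ :- r :+ s :- con 1ℚ) ≡.refl (value r) (value s)))

  ¬ᵘ-involutive : ∀ r → value (¬ᵘ ¬ᵘ r) ≡ value r
  ¬ᵘ-involutive r = solve 1 (λ r → con 1ℚ :- (con 1ℚ :- r) := r) ≡.refl (value r)

  ¬ᵘ-positive : ∀ r → value r ℚ.< 1ℚ → 0ℚ ℚ.< value (¬ᵘ r)
  ¬ᵘ-positive r = 0<-

  ¬ᵘ<1 : ∀ r → 0ℚ ℚ.< value r → value (¬ᵘ r) ℚ.< 1ℚ
  ¬ᵘ<1 r 0<r = <-by 0<r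
    (solve 1 (λ r → r := con 1ℚ :- (con 1ℚ :- r)) ≡.refl (value r))

  ¬ᵘ⊕ᵘ<1 : ∀ r s → value s ℚ.< value r → value (¬ᵘ r ⊕ᵘ s) ℚ.< 1ℚ
  ¬ᵘ⊕ᵘ<1 r s s<r = ℚ.≤-<-trans (⊕ᵘ≤ (¬ᵘ r) s) (<-by (0<- s<r)
    (solve 2 (λ r s → r :- s := con 1ℚ :- (con 1ℚ :- r :+ s)) ≡.refl (value r) (value s)))

  ≤+¬ᵘ⇒·ᵘ≤ : ∀ q p t → value q ℚ.≤ value p ℚ.+ value (¬ᵘ t) → value (q ·ᵘ t) ℚ.≤ value p
  ≤+¬ᵘ⇒·ᵘ≤ q p t q≤ = ·ᵘ≤ q t (0≤ p) (≤-by (0≤- q≤)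
    (solve 3 (λ q p t → p :+ (con 1ℚ :- t) :- q := p :- (q :+ t :- con 1ℚ)) ≡.refl
      (value q) (value p) (value t)))

  ·ᵘ< : ∀ q c → 0ℚ ℚ.< value q → value c ℚ.< 1ℚ → value (q ·ᵘ c) ℚ.< value q
  ·ᵘ< q c 0<q c<1 = [
      (λ ≤0 → ℚ.≤-<-trans (·ᵘ≤ q c ℚ.≤-refl ≤0) 0<q)
    , (λ 0≤ → ℚ.≤-<-trans (·ᵘ≤ q c 0≤ ℚ.≤-refl) (shift c<1))
    ]′ (ℚ.≤-total (value q ℚ.+ value c ℚ.- 1ℚ) 0ℚ)
    where
    shift : ∀ {c} → c ℚ.< 1ℚ → value q ℚ.+ c ℚ.- 1ℚ ℚ.< value q
    shift {c} c<1 = <-by (0<- c<1)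
      (solve 2 (λ q c → con 1ℚ :- c := q :- (q :+ c :- con 1ℚ)) ≡.refl (value q) c)

  -- The midpoint (1 + c)/2 of c and 1 is a square root of c for the Łukasiewicz product, since
  -- twice it minus 1 is c.
  midpoint-square : ∀ c → value c ≡ value (¬ᵘ half (¬ᵘ c) ·ᵘ ¬ᵘ half (¬ᵘ c))
  midpoint-square c = ℚ.≤-antisym
    (ℚ.≤-trans (ℚ.≤-reflexive eq) (≤·ᵘ h h))
    (·ᵘ≤ h h (0≤ c) (ℚ.≤-reflexive (≡.sym eq)))
    where
    h : Unitℚ
    h = ¬ᵘ half (¬ᵘ c)
    eq : value c ≡ value h ℚ.+ value h ℚ.- 1ℚ
    eq = solve 1 (λ c → c := con 1ℚ :- con ½ :* (con 1ℚ :- c)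
                             :+ (con 1ℚ :- con ½ :* (con 1ℚ :- c)) :- con 1ℚ) ≡.refl (value c)

  half≤¬half : ∀ r → value (half r) ℚ.≤ value (¬ᵘ half r)
  half≤¬half r = ≤-by (0≤- (≤1 r))
    (solve 1 (λ r → con 1ℚ :- r := con 1ℚ :- con ½ :* r :- con ½ :* r) ≡.refl (value r))

  -- Each summand loses at most half of t - p, so the sum loses at most t - p.
  ⊕ᵘ-bracket : ∀ p t p≤t {r r′ s s′} → let δ = half (difference p t p≤t) in
               value t ℚ.≤ value (r′ ⊕ᵘ s′) →
               value r′ ℚ.≤ value r ℚ.+ value δ → value s′ ℚ.≤ value s ℚ.+ value δ →
               value p ℚ.≤ value (r ⊕ᵘ s)
  ⊕ᵘ-bracket p t p≤t {r} {r′} {s} {s′} t≤ r′≤ s′≤ = ≤⊕ᵘ r s (≤1 p)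
    (≤-by (0≤+ (0≤- (ℚ.≤-trans t≤ (⊕ᵘ≤ r′ s′))) (0≤+ (0≤- r′≤) (0≤- s′≤)))
      (solve 6 (λ p t r r′ s s′ →
          r′ :+ s′ :- t :+ (r :+ con ½ :* (t :- p) :- r′ :+ (s :+ con ½ :* (t :- p) :- s′))
          := r :+ s :- p) ≡.refl
        (value p) (value t) (value r) (value r′) (value s) (value s′)))

  -- If p · q ≤ s, the two errors add up to at most m - s and give p′ · q′ ≤ m; the gap between m
  -- and t refutes this.
  ·ᵘ-bracket : ∀ s m t s≤m {p p′ q q′} → let δ = half (difference s m s≤m) in
               value m ℚ.< value t → value t ℚ.≤ value (p′ ·ᵘ q′) →
               value p′ ℚ.≤ value p ℚ.+ value δ → value q′ ℚ.≤ value q ℚ.+ value δ →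
               value s ℚ.< value (p ·ᵘ q)
  ·ᵘ-bracket s m t s≤m {p} {p′} {q} {q′} m<t t≤ p′≤ q′≤ = ℚ.≰⇒> λ pq≤s →
    ℚ.<-irrefl ≡.refl (ℚ.<-≤-trans m<t (ℚ.≤-trans t≤ (·ᵘ≤ p′ q′ (0≤ m)
      (≤-by (0≤+ (0≤- (ℚ.≤-trans (≤·ᵘ p q) pq≤s)) (0≤+ (0≤- p′≤) (0≤- q′≤)))
        (solve 6 (λ s m p p′ q q′ →
            s :- (p :+ q :- con 1ℚ) :+
            (p :+ con ½ :* (m :- s) :- p′ :+ (q :+ con ½ :* (m :- s) :- q′))
            := m :- (p′ :+ q′ :- con 1ℚ)) ≡.refl
          (value s) (value m) (value p) (value p′) (value q) (value q′))))))

-- Density and approximation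

<-denseᵘ : ∀ {r s} → value r ℚ.< value s →
           ∃ λ m → value r ℚ.< value m × value m ℚ.< value s
<-denseᵘ {r} {s} r<s with ℚ.<-dense r<s
... | m , r<m , m<s = unit m (ℚ.≤-trans (0≤ r) (ℚ.<⇒≤ r<m)) (ℚ.≤-trans (ℚ.<⇒≤ m<s) (≤1 s))
                    , r<m , m<s

≤-fromᵘ : ∀ {q r} → (∀ p → value p ℚ.< value q → value p ℚ.≤ value r) → value q ℚ.≤ value r
≤-fromᵘ {q} {r} h = ℚ.≮⇒≥ λ r<q →
  let (m , r<m , m<q) = <-denseᵘ {r} {q} r<q in ℚ.<-irrefl ≡.refl (ℚ.<-≤-trans r<m (h m m<q))

multiple-nonneg : ∀ {δ} → 0ℚ ℚ.≤ δ → ∀ n → 0ℚ ℚ.≤ multiple n δ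
multiple-nonneg 0≤δ ℕ.zero    = ℚ.≤-refl
multiple-nonneg 0≤δ (ℕ.suc n) = 0≤+ 0≤δ (multiple-nonneg 0≤δ n)

-- A walk down from 1 in steps of δ, stopped when `total` first answers Lo; the Archimedean property
-- bounds its length. It stands in for a supremum of Lo.
descent : ∀ {ℓ₁ ℓ₂} {Lo : Pred Unitℚ ℓ₁} {Hi : Pred Unitℚ ℓ₂} →
          (∀ q → Lo q ⊎ Hi q) → Hi 1ᵘ → (∀ q → value q ℚ.≤ 0ℚ → Lo q) →
          ∀ δ → 0ℚ ℚ.< value δ →
          ∃₂ λ p q → Lo p × Hi q × value q ℚ.≤ value p ℚ.+ value δ
descent {Lo = Lo} {Hi} total hi₁ lo₀ δ 0<δ =
  let (n , 1≤nδ) = archimedean 0<δ in go n 1ᵘ hi₁ 1≤nδ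
  where
  go : ∀ n q → Hi q → value q ℚ.≤ multiple n (value δ) →
       ∃₂ λ p q → Lo p × Hi q × value q ℚ.≤ value p ℚ.+ value δ
  -- With no steps left q ≤ 0, so q itself lies in both Lo and Hi.
  go ℕ.zero q hi q≤0 = q , q , lo₀ q q≤0 , hi ,
    ≡.subst (ℚ._≤ (value q ℚ.+ value δ)) (ℚ.+-identityʳ (value q)) (ℚ.+-monoʳ-≤ (value q) (0≤ δ))
  go (ℕ.suc n) q hi q≤ = [
      (λ lo → q ·ᵘ ¬ᵘ δ , q , lo , hi , ≤-·ᵘ-¬ᵘ q δ)
    , (λ hi′ → go n (q ·ᵘ ¬ᵘ δ) hi′ (≤+⇒·ᵘ-¬ᵘ≤ q δ (multiple-nonneg (0≤ δ) n) q≤))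
    ]′ (total (q ·ᵘ ¬ᵘ δ))

-- MV-algebras and their filters

module MVProperties {c ℓ} {M : RawMV c ℓ} (isMV : IsMV M) where
  open RawMV M
  open IsMV isMV public
  open IsCommutativeMonoid isCommutativeMonoid public
    using (refl; reflexive; sym; trans; setoid)
    renaming (assoc to ⊕-assoc; comm to ⊕-comm; ∙-cong to ⊕-cong;
              identityˡ to ⊕-identityˡ)
  open ≈-Reasoning setoid

  ⊕-congˡ : ∀ {x y z} → y ≈ z → x ⊕ y ≈ x ⊕ z
  ⊕-congˡ = ⊕-cong refl

  ⊕-congʳ : ∀ {x y z} → y ≈ z → y ⊕ x ≈ z ⊕ x
  ⊕-congʳ y≈z = ⊕-cong y≈z refl

  ⊕-zeroˡ : ∀ x → 1# ⊕ x ≈ 1#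
  ⊕-zeroˡ x = trans (⊕-comm 1# x) (⊕-zeroʳ x)

  ⇒-identityˡ : ∀ x → 1# ⇒ x ≈ x
  ⇒-identityˡ x = trans (⊕-congʳ (¬-involutive 0#)) (⊕-identityˡ x)

  -- The Łukasiewicz axiom with 1 as one argument.
  ≤-refl : ∀ {x} → x ≤ x
  ≤-refl {x} = begin
    ¬ x ⊕ x                ≈⟨ ⊕-congʳ (¬-cong (⇒-identityˡ x)) ⟨
    ¬ (¬ 1# ⊕ x) ⊕ x       ≈⟨ łukasiewicz x 1# ⟨
    ¬ (¬ x ⊕ 1#) ⊕ 1#      ≈⟨ ⊕-zeroʳ _ ⟩
    1#                     ∎

  ⊕-upperˡ : ∀ x z → x ≤ x ⊕ z
  ⊕-upperˡ x z = begin
    ¬ x ⊕ (x ⊕ z)  ≈⟨ ⊕-assoc _ _ _ ⟨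
    ¬ x ⊕ x ⊕ z    ≈⟨ ⊕-congʳ ≤-refl ⟩
    1# ⊕ z         ≈⟨ ⊕-zeroˡ z ⟩
    1#             ∎

  ≤-respʳ : ∀ {x y z} → y ≈ z → x ≤ y → x ≤ z
  ≤-respʳ y≈z x≤y = trans (⊕-congˡ (sym y≈z)) x≤y

  ≤-respˡ : ∀ {x y z} → x ≈ y → x ≤ z → y ≤ z
  ≤-respˡ x≈y x≤z = trans (⊕-congʳ (¬-cong (sym x≈y))) x≤z

  ≈⇒≤ : ∀ {x y} → x ≈ y → x ≤ y
  ≈⇒≤ x≈y = ≤-respʳ x≈y ≤-refl

  ≤⇒∨≈ : ∀ {x y} → x ≤ y → x ∨ y ≈ y
  ≤⇒∨≈ {x} {y} x≤y = begin
    ¬ (¬ x ⊕ y) ⊕ y  ≈⟨ ⊕-congʳ (¬-cong x≤y) ⟩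
    1# ⇒ y           ≈⟨ ⇒-identityˡ y ⟩
    y                ∎

  ≤-antisym : ∀ {x y} → x ≤ y → y ≤ x → x ≈ y
  ≤-antisym {x} {y} x≤y y≤x = trans (sym (≤⇒∨≈ y≤x)) (trans (łukasiewicz y x) (≤⇒∨≈ x≤y))

  -- The witness is the truncated difference of y and x; adding it back to x gives y ∨ x, which is
  -- y. This makes transitivity a matter of associativity.
  ≤-complement : ∀ {x y} → x ≤ y → ∃ λ z → x ⊕ z ≈ y
  ≤-complement {x} {y} x≤y = ¬ (¬ y ⊕ x) ,
    trans (⊕-comm _ _) (trans (łukasiewicz y x) (≤⇒∨≈ x≤y))

  ≤-trans : ∀ {x y z} → x ≤ y → y ≤ z → x ≤ z
  ≤-trans {x} x≤y y≤z =
    let (u , x⊕u≈y) = ≤-complement x≤y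
        (v , y⊕v≈z) = ≤-complement y≤z
    in ≤-respʳ (trans (sym (⊕-assoc x u v)) (trans (⊕-congʳ x⊕u≈y) y⊕v≈z)) (⊕-upperˡ x (u ⊕ v))

  ≤-maximum : ∀ x → x ≤ 1#
  ≤-maximum x = ⊕-zeroʳ (¬ x)

  ≤-minimum : ∀ x → 0# ≤ x
  ≤-minimum x = ⊕-zeroˡ x

  1≤⇒≈1 : ∀ {x} → 1# ≤ x → x ≈ 1#
  1≤⇒≈1 1≤x = ≤-antisym (≤-maximum _) 1≤x

  ⊕-upperʳ : ∀ x z → z ≤ x ⊕ z
  ⊕-upperʳ x z = ≤-respʳ (⊕-comm z x) (⊕-upperˡ z x)

  ⇒-contrapositive : ∀ x y → x ⇒ y ≈ ¬ y ⇒ ¬ x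
  ⇒-contrapositive x y = trans (⊕-comm _ _) (⊕-congʳ (sym (¬-involutive y)))

  ¬-anti : ∀ {x y} → x ≤ y → ¬ y ≤ ¬ x
  ¬-anti {x} {y} x≤y = trans (sym (⇒-contrapositive x y)) x≤y

  ∨-upperʳ : ∀ x y → y ≤ x ∨ y
  ∨-upperʳ x y = ⊕-upperʳ _ y

  ∨-comm : ∀ x y → x ∨ y ≈ y ∨ x
  ∨-comm = łukasiewicz

  ∨-upperˡ : ∀ x y → x ≤ x ∨ y
  ∨-upperˡ x y = ≤-respʳ (∨-comm y x) (∨-upperʳ y x)

  -- Up to a double negation ¬ (x ⊕ z) ⊕ z is ¬ x ∨ z, which lies above ¬ x; adding y gives the
  -- claim.
  ⇒-⊕-mono : ∀ x y z → x ⇒ y ≤ (x ⊕ z) ⇒ (y ⊕ z)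
  ⇒-⊕-mono x y z =
    let (u , ¬x⊕u≈¬x∨z) = ≤-complement (∨-upperˡ (¬ x) z)
    in ≤-respʳ (begin
      ¬ x ⊕ y ⊕ u               ≈⟨ ⊕-assoc _ _ _ ⟩
      ¬ x ⊕ (y ⊕ u)             ≈⟨ ⊕-congˡ (⊕-comm y u) ⟩
      ¬ x ⊕ (u ⊕ y)             ≈⟨ ⊕-assoc _ _ _ ⟨
      ¬ x ⊕ u ⊕ y               ≈⟨ ⊕-congʳ ¬x⊕u≈¬x∨z ⟩
      ¬ (¬ ¬ x ⊕ z) ⊕ z ⊕ y     ≈⟨ ⊕-congʳ (⊕-congʳ (¬-cong (⊕-congʳ (¬-involutive x)))) ⟩
      ¬ (x ⊕ z) ⊕ z ⊕ y         ≈⟨ ⊕-assoc _ _ _ ⟩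
      ¬ (x ⊕ z) ⊕ (z ⊕ y)       ≈⟨ ⊕-congˡ (⊕-comm z y) ⟩
      ¬ (x ⊕ z) ⊕ (y ⊕ z)       ∎)
      (⊕-upperˡ (¬ x ⊕ y) u)

  ⊕-monoʳ : ∀ {x y z} → x ≤ y → x ⊕ z ≤ y ⊕ z
  ⊕-monoʳ {x} {y} {z} x≤y = 1≤⇒≈1 (≤-respˡ x≤y (⇒-⊕-mono x y z))

  ⊕-mono : ∀ {x y u v} → x ≤ y → u ≤ v → x ⊕ u ≤ y ⊕ v
  ⊕-mono {x} {y} {u} {v} x≤y u≤v = ≤-trans (⊕-monoʳ x≤y)
    (≤-respˡ (⊕-comm u y) (≤-respʳ (⊕-comm v y) (⊕-monoʳ u≤v)))

  ·-mono : ∀ {x y u v} → x ≤ y → u ≤ v → x · u ≤ y · v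
  ·-mono x≤y u≤v = ¬-anti (⊕-mono (¬-anti x≤y) (¬-anti u≤v))

  ⇒-mono : ∀ {x y u v} → y ≤ x → u ≤ v → x ⇒ u ≤ y ⇒ v
  ⇒-mono y≤x u≤v = ⊕-mono (¬-anti y≤x) u≤v

  ·-comm : ∀ x y → x · y ≈ y · x
  ·-comm x y = ¬-cong (⊕-comm _ _)

  ⇒-curry : ∀ x y z → (x · y) ⇒ z ≈ x ⇒ (y ⇒ z)
  ⇒-curry x y z = trans (⊕-congʳ (¬-involutive _)) (⊕-assoc _ _ _)

  ≤⇒-⇒·≤ : ∀ {x y z} → x ≤ y ⇒ z → x · y ≤ z
  ≤⇒-⇒·≤ {x} {y} {z} x≤ = trans (⇒-curry x y z) x≤

  ·≤⇒≤⇒ : ∀ {x y z} → x · y ≤ z → x ≤ y ⇒ z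
  ·≤⇒≤⇒ {x} {y} {z} ≤z = trans (sym (⇒-curry x y z)) ≤z

  ·-assoc : ∀ x y z → x · y · z ≈ x · (y · z)
  ·-assoc x y z = ¬-cong (begin
    ¬ ¬ (¬ x ⊕ ¬ y) ⊕ ¬ z    ≈⟨ ⊕-congʳ (¬-involutive _) ⟩
    ¬ x ⊕ ¬ y ⊕ ¬ z          ≈⟨ ⊕-assoc _ _ _ ⟩
    ¬ x ⊕ (¬ y ⊕ ¬ z)        ≈⟨ ⊕-congˡ (¬-involutive _) ⟨
    ¬ x ⊕ ¬ ¬ (¬ y ⊕ ¬ z)    ∎)

  ·-lowerˡ : ∀ x y → x · y ≤ x
  ·-lowerˡ x y = ≤-respʳ (¬-involutive x) (¬-anti (⊕-upperˡ (¬ x) (¬ y)))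

  ·-lowerʳ : ∀ x y → x · y ≤ y
  ·-lowerʳ x y = ≤-respˡ (·-comm y x) (·-lowerˡ y x)

  ·-identityʳ : ∀ x → x · 1# ≈ x
  ·-identityʳ x = begin
    ¬ (¬ x ⊕ ¬ 1#)  ≈⟨ ¬-cong (⊕-comm _ _) ⟩
    ¬ (1# ⇒ ¬ x)    ≈⟨ ¬-cong (⇒-identityˡ (¬ x)) ⟩
    ¬ ¬ x           ≈⟨ ¬-involutive x ⟩
    x               ∎

  -- x ∨ y ≤ z ∨ y = z, because x occurs in x ∨ y under two negations.
  ∨-lub : ∀ {x y z} → x ≤ z → y ≤ z → x ∨ y ≤ z
  ∨-lub {x} {y} {z} x≤z y≤z = ≤-respʳ (trans (∨-comm z y) (≤⇒∨≈ y≤z))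
    (⊕-monoʳ (¬-anti (⊕-monoʳ (¬-anti x≤z))))

  ∨-mono : ∀ {x y u v} → x ≤ y → u ≤ v → x ∨ u ≤ y ∨ v
  ∨-mono {y = y} {v = v} x≤y u≤v =
    ∨-lub (≤-trans x≤y (∨-upperˡ y v)) (≤-trans u≤v (∨-upperʳ y v))

  ∧-lowerˡ : ∀ x y → x ∧ y ≤ x
  ∧-lowerˡ x y = ≤-respʳ (¬-involutive x) (¬-anti (∨-upperˡ (¬ x) (¬ y)))

  ∧-lowerʳ : ∀ x y → x ∧ y ≤ y
  ∧-lowerʳ x y = ≤-respʳ (¬-involutive y) (¬-anti (∨-upperʳ (¬ x) (¬ y)))

  ∧-glb : ∀ {x y z} → z ≤ x → z ≤ y → z ≤ x ∧ y
  ∧-glb {z = z} z≤x z≤y = ≤-respˡ (¬-involutive z) (¬-anti (∨-lub (¬-anti z≤x) (¬-anti z≤y)))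

  ·-distribˡ-∨ : ∀ x y z → x · (y ∨ z) ≤ x · y ∨ x · z
  ·-distribˡ-∨ x y z = ≤-respˡ (·-comm _ x) (≤⇒-⇒·≤ (∨-lub
    (·≤⇒≤⇒ (≤-respˡ (·-comm x y) (∨-upperˡ _ _)))
    (·≤⇒≤⇒ (≤-respˡ (·-comm x z) (∨-upperʳ _ _)))))

  -- Expanding the product, every term except x · y is below z.
  ∨-·-distrib : ∀ x y z → (x ∨ z) · (y ∨ z) ≤ x · y ∨ z
  ∨-·-distrib x y z = ≤-trans (·-distribˡ-∨ (x ∨ z) y z) (∨-lub
    (≤-trans (≤-respˡ (·-comm y (x ∨ z)) (·-distribˡ-∨ y x z))
      (∨-mono (≈⇒≤ (·-comm y x)) (·-lowerʳ y z)))
    (≤-trans (·-lowerʳ _ z) (∨-upperʳ _ z)))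

  modus-ponens : ∀ x y → (x ⇒ y) · x ≤ y
  modus-ponens x y = ≤⇒-⇒·≤ ≤-refl

  ·-congʳ : ∀ {x y z} → y ≈ z → y · x ≈ z · x
  ·-congʳ y≈z = ¬-cong (⊕-congʳ (¬-cong y≈z))

  ⇒-trans : ∀ x y z → (x ⇒ y) · (y ⇒ z) ≤ x ⇒ z
  ⇒-trans x y z = ·≤⇒≤⇒ (≤-respˡ
    (trans (sym (·-assoc _ _ x)) (·-congʳ (·-comm _ _)))
    (≤-trans (·-mono ≤-refl (modus-ponens x y)) (modus-ponens y z)))

  divisibility : ∀ x y → x ∧ y ≈ (y ⇒ x) · y
  divisibility x y = ¬-cong (⊕-congʳ (¬-cong
    (trans (⊕-comm _ _) (⊕-congˡ (¬-involutive x)))))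

  -- With z = x ∨ y, divisibility gives x ≤ (y ⇒ x) · z and y ≤ (x ⇒ y) · z,
  -- so z ≤ w · z for w = (x ⇒ y) ∨ (y ⇒ x); as ¬ z ≤ w, this forces w = 1.
  prelinearity : ∀ x y → (x ⇒ y) ∨ (y ⇒ x) ≈ 1#
  prelinearity x y = begin
    w                    ≈⟨ ≤⇒∨≈ ¬z≤w ⟨
    ¬ z ∨ w              ≈⟨ ∨-comm (¬ z) w ⟩
    ¬ (¬ w ⊕ ¬ z) ⊕ ¬ z  ≈⟨ ⊕-comm _ _ ⟩
    ¬ z ⊕ ¬ (¬ w ⊕ ¬ z)  ≈⟨ z≤w·z ⟩
    1#                   ∎
    where
    z w : Carrier
    z = x ∨ y
    w = (x ⇒ y) ∨ (y ⇒ x)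

    below : ∀ {a b} → a ≤ z → b ≤ z → a ≤ (b ⇒ a) · z
    below a≤z b≤z = ≤-trans (∧-glb ≤-refl a≤z)
      (≤-trans (≈⇒≤ (divisibility _ z)) (·-mono (⇒-mono b≤z ≤-refl) ≤-refl))

    z≤w·z : z ≤ w · z
    z≤w·z = ∨-lub
      (≤-trans (below (∨-upperˡ x y) (∨-upperʳ x y)) (·-mono (∨-upperʳ _ _) ≤-refl))
      (≤-trans (below (∨-upperʳ x y) (∨-upperˡ x y)) (·-mono (∨-upperˡ _ _) ≤-refl))

    ¬z≤w : ¬ z ≤ w
    ¬z≤w = ≤-trans (¬-anti (∨-upperˡ x y)) (≤-trans (⊕-upperˡ (¬ x) y) (∨-upperˡ _ _))

  -- Filters and the preorder modulo a filter

  module FilterProperties {a} {F : Pred Carrier a} (isFilter : IsFilter M F) where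
    open IsFilter isFilter public

    infix 4 _⊑_
    _⊑_ : Carrier → Carrier → Set a
    x ⊑ y = (x ⇒ y) ∈ F

    ∈-resp : ∀ {x y} → x ≈ y → x ∈ F → y ∈ F
    ∈-resp x≈y = upward (≈⇒≤ x≈y)

    ≤⇒⊑ : ∀ {x y} → x ≤ y → x ⊑ y
    ≤⇒⊑ x≤y = ∈-resp (sym x≤y) 1-closed

    ⊑-refl : ∀ {x} → x ⊑ x
    ⊑-refl = ≤⇒⊑ ≤-refl

    ⊑-trans : ∀ {x y z} → x ⊑ y → y ⊑ z → x ⊑ z
    ⊑-trans x⊑y y⊑z = upward (⇒-trans _ _ _) (·-closed x⊑y y⊑z)

    ¬-⊑-anti : ∀ {x y} → x ⊑ y → ¬ y ⊑ ¬ x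
    ¬-⊑-anti = ∈-resp (⇒-contrapositive _ _)

    ⊕-⊑-mono : ∀ {x y u v} → x ⊑ y → u ⊑ v → x ⊕ u ⊑ y ⊕ v
    ⊕-⊑-mono x⊑y u⊑v = ⊑-trans (upward (⇒-⊕-mono _ _ _) x⊑y)
      (⊑-trans (≤⇒⊑ (≈⇒≤ (⊕-comm _ _)))
        (⊑-trans (upward (⇒-⊕-mono _ _ _) u⊑v) (≤⇒⊑ (≈⇒≤ (⊕-comm _ _)))))

    ·-⊑-mono : ∀ {x y u v} → x ⊑ y → u ⊑ v → x · u ⊑ y · v
    ·-⊑-mono x⊑y u⊑v = ¬-⊑-anti (⊕-⊑-mono (¬-⊑-anti x⊑y) (¬-⊑-anti u⊑v))

    ⇒-⊑-mono : ∀ {x y u v} → y ⊑ x → u ⊑ v → (x ⇒ u) ⊑ (y ⇒ v)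
    ⇒-⊑-mono y⊑x u⊑v = ⊕-⊑-mono (¬-⊑-anti y⊑x) u⊑v

    ⊑-curry : ∀ {x y z} → x · y ⊑ z → x ⊑ (y ⇒ z)
    ⊑-curry = ∈-resp (⇒-curry _ _ _)

    ⊑-uncurry : ∀ {x y z} → x ⊑ (y ⇒ z) → x · y ⊑ z
    ⊑-uncurry = ∈-resp (sym (⇒-curry _ _ _))

    1⊑⇒∈ : ∀ {x} → 1# ⊑ x → x ∈ F
    1⊑⇒∈ = ∈-resp (⇒-identityˡ _)

    ∈⇒⊒ : ∀ {x y} → x ∈ F → y ⊑ x
    ∈⇒⊒ = upward (⊕-upperʳ _ _)

    ∈-⊑ : ∀ {x y} → x ∈ F → x ⊑ y → y ∈ F
    ∈-⊑ x∈F x⊑y = upward (≤-respˡ (·-comm _ _) (modus-ponens _ _)) (·-closed x∈F x⊑y)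

    ∨∈-isFilter : ∀ v → IsFilter M (λ z → z ∨ v ∈ F)
    ∨∈-isFilter v = record
      { 1-closed = upward (∨-upperˡ 1# v) 1-closed
      ; ·-closed = λ x∈ y∈ → upward (∨-·-distrib _ _ v) (·-closed x∈ y∈)
      ; upward   = λ x≤y → upward (∨-mono x≤y ≤-refl)
      }

    -- The filter generated by S and F.
    above-isFilter : ∀ {b} {S : Pred Carrier b} → IsFilter M S →
                     IsFilter M (λ z → ∃ λ s → s ∈ S × s ⊑ z)
    above-isFilter S-isFilter = record
      { 1-closed = 1# , S.1-closed , ⊑-refl
      ; ·-closed = λ (s , s∈S , s⊑x) (t , t∈S , t⊑y) →
                     s · t , S.·-closed s∈S t∈S , ·-⊑-mono s⊑x t⊑y
      ; upward   = λ x≤y (s , s∈S , s⊑x) → s , s∈S , ⊑-trans s⊑x (≤⇒⊑ x≤y)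
      }
      where module S = IsFilter S-isFilter

-- Maximal filters

lower-em : ∀ {ℓ} → ExcludedMiddle (suc ℓ) → ExcludedMiddle ℓ
lower-em {ℓ} em {P} = map′ lower lift (em {Lift (suc ℓ) P})

module Maximal {ℓ} (em : ExcludedMiddle (suc ℓ)) (zorn : Zorn (suc ℓ) ℓ ℓ)
               {M : RawMV ℓ ℓ} (isMV : IsMV M) where
  open RawMV M
  open MVProperties isMV

  em₀ : ExcludedMiddle ℓ
  em₀ = lower-em em

  -- A copy of P in the lower universe, which keeps the union of a chain of
  -- filters a predicate at level ℓ.
  Resize : Set (suc ℓ) → Set ℓ
  Resize P = Lift ℓ (True (em {P}))

  resize : ∀ {P} → P → Resize P
  resize p = lift (fromWitness p)

  unresize : ∀ {P} → Resize P → P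
  unresize (lift p) = toWitness p

  record ProperFilter (G : Pred Carrier ℓ) : Set (suc ℓ) where
    field
      filter   : Pred Carrier ℓ
      isFilter : IsFilter M filter
      proper   : IsProper M filter
      contains : G ⊆ filter
    open IsFilter isFilter public

  extend : ∀ {G} → IsFilter M G → IsProper M G → ∃ λ (F : Spec M) → G ⊆ Spec.filter F
  extend {G} G-isFilter G-proper = record
    { filter   = m.filter
    ; isFilter = m.isFilter
    ; proper   = m.proper
    ; maximal  = λ H H-isFilter H-proper m⊆H → m-maximal
        {record { filter = H ; isFilter = H-isFilter ; proper = H-proper
                ; contains = λ x∈G → m⊆H (m.contains x∈G) }} m⊆H
    } , m.contains
    where
    poset : Poset (suc ℓ) ℓ ℓ
    poset = record
      { Carrier = ProperFilter G
      ; _≈_     = λ F H → F .filter ⊆ H .filter × H .filter ⊆ F .filter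
      ; _≤_     = λ F H → F .filter ⊆ H .filter
      ; isPartialOrder = record
        { isPreorder = record
          { isEquivalence = record
            { refl  = id , id
            ; sym   = swap
            ; trans = λ (f , f′) (g , g′) → (λ x → g (f x)) , (λ x → f′ (g′ x))
            }
          ; reflexive = proj₁
          ; trans     = λ f g x → g (f x)
          }
        ; antisym = _,_
        }
      } where open ProperFilter

    module _ (C : Pred (ProperFilter G) (suc ℓ))
             (chain : ∀ {H K} → H ∈ C → K ∈ C →
                      (ProperFilter.filter H ⊆ ProperFilter.filter K) ⊎
                      (ProperFilter.filter K ⊆ ProperFilter.filter H)) where
      open ProperFilter

      -- G is put into the union so that the empty chain has an upper bound too.
      InUnion : Pred Carrier (suc ℓ)
      InUnion x = x ∈ G ⊎ ∃ λ H → H ∈ C × x ∈ H .filter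

      ·-closed-union : ∀ {x y} → x ∈ InUnion → y ∈ InUnion → x · y ∈ InUnion
      ·-closed-union (inj₁ x∈G) (inj₁ y∈G) = inj₁ (IsFilter.·-closed G-isFilter x∈G y∈G)
      ·-closed-union (inj₁ x∈G) (inj₂ (K , K∈C , y∈K)) =
        inj₂ (K , K∈C , ·-closed K (contains K x∈G) y∈K)
      ·-closed-union (inj₂ (H , H∈C , x∈H)) (inj₁ y∈G) =
        inj₂ (H , H∈C , ·-closed H x∈H (contains H y∈G))
      ·-closed-union (inj₂ (H , H∈C , x∈H)) (inj₂ (K , K∈C , y∈K)) =
        [ (λ H⊆K → inj₂ (K , K∈C , ·-closed K (H⊆K x∈H) y∈K))
        , (λ K⊆H → inj₂ (H , H∈C , ·-closed H x∈H (K⊆H y∈K)))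
        ]′ (chain H∈C K∈C)

      upward-union : ∀ {x y} → x ≤ y → x ∈ InUnion → y ∈ InUnion
      upward-union x≤y (inj₁ x∈G)             = inj₁ (IsFilter.upward G-isFilter x≤y x∈G)
      upward-union x≤y (inj₂ (H , H∈C , x∈H)) = inj₂ (H , H∈C , upward H x≤y x∈H)

      union : ProperFilter G
      union = record
        { filter   = λ x → Resize (InUnion x)
        ; isFilter = record
          { 1-closed = resize (inj₁ (IsFilter.1-closed G-isFilter))
          ; ·-closed = λ x∈ y∈ → resize (·-closed-union (unresize x∈) (unresize y∈))
          ; upward   = λ x≤y x∈ → resize (upward-union x≤y (unresize x∈))
          }
        ; proper   = λ 0∈ → [ G-proper , (λ (H , _ , 0∈H) → proper H 0∈H) ]′ (unresize 0∈)
        ; contains = λ x∈G → resize (inj₁ x∈G)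
        }

    bound : ∃ λ m → ∀ {H} → Poset._≤_ poset m H → Poset._≤_ poset H m
    bound = zorn poset λ C chain →
      union C chain , λ {H} H∈C x∈H → resize (inj₂ (H , H∈C , x∈H))

    module m = ProperFilter (proj₁ bound)
    m-maximal = proj₂ bound

  module _ (F : Spec M) where
    open Spec F
    open FilterProperties isFilter

    -- If y ⇒ x is not in F, the filter of all z with z ∨ (y ⇒ x) in F is proper and contains F, so
    -- it is F by maximality; prelinearity puts x ⇒ y into it.
    ⊑-total : ∀ x y → x ⊑ y ⊎ y ⊑ x
    ⊑-total x y with em₀ {0# ∨ (y ⇒ x) ∈ filter}
    ... | yes 0∨∈ = inj₂ (∈-resp (≤⇒∨≈ (≤-minimum _)) 0∨∈)
    ... | no  0∨∉ = inj₁ (maximal _ (∨∈-isFilter (y ⇒ x)) 0∨∉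
      (λ z∈F → upward (∨-upperˡ _ _) z∈F) (∈-resp (sym (prelinearity x y)) 1-closed))

  -- Some coordinate of the subdirect product does not send z to 1, and its kernel is a maximal
  -- filter because the factor is simple.
  separate : Semisimple M → ∀ {z} → Not (z ≈ 1#) → ∃ λ (F : Spec M) → z ∉ Spec.filter F
  separate ss {z} z≉1 with em₀ {∃ λ i → Not (RawMV._≈_ (Semisimple.factor ss i) (Semisimple.π ss i z) (RawMV.1# (Semisimple.factor ss i)))}
  ... | no  none = contradiction
    (Semisimple.injective ss λ i → N.trans i
      (decidable-stable em₀ λ πz≉1 → none (i , πz≉1)) (N.sym i (π-1 i)))
    z≉1
    where
    open Semisimple ss
    module N i = MVProperties (Semisimple.isMV ss i)
    π-1 : ∀ i → RawMV._≈_ (factor i) (π i 1#) (RawMV.1# (factor i))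
    π-1 i = N.trans i (IsMVHomomorphism.¬-homo (π-homo i) 0#)
             (N.¬-cong i (IsMVHomomorphism.0-homo (π-homo i)))
  ... | yes (i , πz≉1) = F , πz≉1
    where
    open Semisimple ss using (isSimple; surjective)
    module N = RawMV (Semisimple.factor ss i)
    module NP = MVProperties (Semisimple.isMV ss i)
    open IsMVHomomorphism (Semisimple.π-homo ss i)
    h = Semisimple.π ss i

    h-1 : h 1# N.≈ N.1#
    h-1 = NP.trans (¬-homo 0#) (NP.¬-cong 0-homo)

    h-⇒ : ∀ x y → h (x ⇒ y) N.≈ (h x N.⇒ h y)
    h-⇒ x y = NP.trans (⊕-homo _ _) (NP.⊕-congʳ (¬-homo x))

    h-· : ∀ x y → h (x · y) N.≈ (h x N.· h y)
    h-· x y = NP.trans (¬-homo _) (NP.¬-cong (NP.trans (h-⇒ _ _) (NP.⊕-congˡ (¬-homo y))))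

    h-mono : ∀ {x y} → x ≤ y → h x N.≤ h y
    h-mono x≤y = NP.trans (NP.sym (h-⇒ _ _)) (NP.trans (cong x≤y) h-1)

    kernel : Pred Carrier ℓ
    kernel x = h x N.≈ N.1#

    kernel-isFilter : IsFilter M kernel
    kernel-isFilter = record
      { 1-closed = h-1
      ; ·-closed = λ hx≈1 hy≈1 → NP.trans (h-· _ _)
          (NP.trans (NP.¬-cong (NP.⊕-cong (NP.¬-cong hx≈1) (NP.¬-cong hy≈1)))
            (NP.·-identityʳ N.1#))
      ; upward   = λ x≤y hx≈1 → NP.1≤⇒≈1 (NP.≤-respˡ hx≈1 (h-mono x≤y))
      }

    -- A proper filter G above the kernel induces a congruence of the simple
    -- algebra, which is then the equality (so G is the kernel).
    module _ (G : Pred Carrier ℓ) (G-isFilter : IsFilter M G) (G-proper : IsProper M G)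
             (kernel⊆G : kernel ⊆ G) where
      module G = FilterProperties G-isFilter

      image : Pred N.Carrier ℓ
      image u = ∃ λ x → x ∈ G × h x N.≈ u

      image-isFilter : IsFilter (Semisimple.factor ss i) image
      image-isFilter = record
        { 1-closed = 1# , G.1-closed , h-1
        ; ·-closed = λ (x , x∈G , hx≈u) (y , y∈G , hy≈v) → x · y , G.·-closed x∈G y∈G ,
            NP.trans (h-· x y) (NP.¬-cong (NP.⊕-cong (NP.¬-cong hx≈u) (NP.¬-cong hy≈v)))
        ; upward   = λ {u} {v} u≤v (x , x∈G , hx≈u) →
            let (y , hy) = surjective i v
                hy≈v     = hy refl
            in y , G.∈-⊑ x∈G (kernel⊆G (NP.trans (h-⇒ x y)
                 (NP.≤-respˡ (NP.sym hx≈u) (NP.≤-respʳ (NP.sym hy≈v) u≤v)))) , hy≈v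
        }
      module I = NP.FilterProperties image-isFilter

      isCongruence : IsCongruence (Semisimple.factor ss i) (λ u v → u I.⊑ v × v I.⊑ u)
      isCongruence = record
        { isEquivalence = record
          { refl  = I.⊑-refl , I.⊑-refl
          ; sym   = swap
          ; trans = λ (p , p′) (q , q′) → I.⊑-trans p q , I.⊑-trans q′ p′
          }
        ; reflexive    = λ u≈v → I.≤⇒⊑ (NP.≈⇒≤ u≈v) , I.≤⇒⊑ (NP.≈⇒≤ (NP.sym u≈v))
        ; ⊕-compatible = λ (p , p′) (q , q′) → I.⊕-⊑-mono p q , I.⊕-⊑-mono p′ q′
        ; ¬-compatible = λ (p , p′) → I.¬-⊑-anti p′ , I.¬-⊑-anti p
        }

      -- If x ∈ G were sent to 0, then x ⇒ 0 would be in the kernel, hence in G, and G would contain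
      -- 0.
      0∉image : N.0# ∉ image
      0∉image (x , x∈G , hx≈0) = G-proper (G.∈-⊑ x∈G (kernel⊆G
        (NP.trans (h-⇒ x 0#) (NP.≤-respˡ (NP.sym hx≈0) (NP.≤-minimum _)))))

      G⊆kernel : G ⊆ kernel
      G⊆kernel {x} x∈G = [
          (λ equal → equal (I.∈⇒⊒ I.1-closed , I.∈⇒⊒ (x , x∈G , NP.refl)))
        , (λ total → contradiction (I.1⊑⇒∈ (proj₂ (total N.0# N.1#))) 0∉image)
        ]′ (IsSimple.congruences (isSimple i) _ isCongruence)

    F : Spec M
    F = record
      { filter   = kernel
      ; isFilter = kernel-isFilter
      ; proper   = λ h0≈1 → IsSimple.nontrivial (isSimple i) (NP.trans (NP.sym 0-homo) h0≈1)
      ; maximal  = G⊆kernel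
      }

-- Cuts in the standard algebra

module StandardProperties {ℓ} (em₀ : ExcludedMiddle ℓ) where
  open RawPavelka (standard ℓ)

  ∈-sup : ∀ (S : Pred Unitℚ ℓ) q s → s ∈ S → value q ℚ.≤ value s → q ∈ cut (sup S)
  ∈-sup S q s s∈S q≤s p p<q = _ , s∈S , ℚ.≤-trans (ℚ.<⇒≤ p<q) q≤s

  ∈-const⁺ : ∀ q r → value q ℚ.≤ value r → q ∈ cut (const r)
  ∈-const⁺ q r q≤r = ∈-sup (λ t → Lift ℓ (value t ≡ value r)) q r (lift ≡.refl) q≤r

  ∈-const⁻ : ∀ q r → q ∈ cut (const r) → value q ℚ.≤ value r
  ∈-const⁻ q r q∈ = ≤-fromᵘ {q} {r} λ p p<q →
    let (s , lift s≡r , p≤s) = q∈ p p<q in ≡.subst (value p ℚ.≤_) s≡r p≤s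

  ∈-¬⁻ : ∀ X p q → q ∈ cut (¬ X) → p ∈ cut X → value q ℚ.≤ value (¬ᵘ p)
  ∈-¬⁻ X p q q∈ p∈X = ≤-fromᵘ {q} {¬ᵘ p} λ r r<q →
    let (s , s≤ , r≤s) = q∈ r r<q
    in ℚ.≤-trans r≤s (≡.subst (value s ℚ.≤_) (≡.sym (value-¬ᵘ p)) (s≤ p p∈X))

  ∈-¬⁺ : ∀ X q → (∀ p → p ∈ cut X → value q ℚ.≤ value (¬ᵘ p)) → q ∈ cut (¬ X)
  ∈-¬⁺ X q h = ∈-sup (λ t → ∀ p → p ∈ cut X → value t ℚ.≤ 1ℚ ℚ.- value p) q q
    (λ p p∈X → ≡.subst (value q ℚ.≤_) (value-¬ᵘ p) (h p p∈X)) ℚ.≤-refl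

  ∈-⊕⁺ : ∀ X Y r s → r ∈ cut X → s ∈ cut Y → r ⊕ᵘ s ∈ cut (X ⊕ Y)
  ∈-⊕⁺ X Y r s r∈X s∈Y =
    ∈-sup (λ t → ∃₂ λ r s → r ∈ cut X × s ∈ cut Y × value t ≡ (value r ℚ.+ value s) ℚ.⊓ 1ℚ)
      (r ⊕ᵘ s) (r ⊕ᵘ s) (r , s , r∈X , s∈Y , value-⊕ᵘ r s) ℚ.≤-refl

  ∈-⊕⁻ : ∀ X Y p q → q ∈ cut (X ⊕ Y) → value p ℚ.< value q →
         ∃₂ λ r s → r ∈ cut X × s ∈ cut Y × value p ℚ.≤ value (r ⊕ᵘ s)
  ∈-⊕⁻ X Y p q q∈ p<q =
    let (m , (r , s , r∈X , s∈Y , m≡) , p≤m) = q∈ p p<q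
    in r , s , r∈X , s∈Y , ≡.subst (value p ℚ.≤_) (≡.trans m≡ (≡.sym (value-⊕ᵘ r s))) p≤m

  approximate : ∀ (X : 𝕀 ℓ) δ → 0ℚ ℚ.< value δ →
                ∃₂ λ p q → p ∈ cut X × (∀ r → r ∈ cut X → value r ℚ.≤ value q) ×
                           value q ℚ.≤ value p ℚ.+ value δ
  approximate X = descent total (λ r _ → ≤1 r)
    -- No rational of the unit interval lies below 0, so `closed` applies vacuously.
    (λ q q≤0 → 𝕀.closed X λ p p<q →
      contradiction (ℚ.≤-<-trans (0≤ p) (ℚ.<-≤-trans p<q q≤0)) (ℚ.<-irrefl ≡.refl))
    where
    total : ∀ q → q ∈ cut X ⊎ (∀ r → r ∈ cut X → value r ℚ.≤ value q)
    total q = Sum.map₂ (λ q∉X r r∈X → [ id , (λ q≤r → contradiction (𝕀.down X q≤r r∈X) q∉X) ]′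
                     (ℚ.≤-total (value r) (value q)))
                   (toSum (em₀ {q ∈ cut X}))

  -- For t < p · q the implication p → t is below q, so it is at most r ⊕ s with r ≤ ¬ X ≤ ¬ p and s
  -- ≤ Y; cancelling gives t ≤ s.
  ∈-⇒⁻ : ∀ X Y p q → q ∈ cut (X ⇒ Y) → p ∈ cut X → p ·ᵘ q ∈ cut Y
  ∈-⇒⁻ X Y p q q∈ p∈X = 𝕀.closed Y λ t t<pq →
    let t≤p = ℚ.≤-trans (ℚ.<⇒≤ t<pq) (·ᵘ≤ˡ p q)
        (r , s , r∈¬X , s∈Y , ¬d≤) = ∈-⊕⁻ (¬ X) Y (¬ᵘ difference t p t≤p) q q∈ (¬difference< t p q t≤p t<pq)
    in 𝕀.down Y (¬difference≤¬⊕ t p t≤p r s (∈-¬⁻ X p r r∈¬X p∈X) ¬d≤) s∈Y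

  -- For t < q, rationals p ≤ X ≤ p′ with p′ - p ≤ q - t give ¬ p′ ⊕ p · q ≥ t, where ¬ p′ ≤ ¬ X and
  -- p · q ≤ Y.
  ∈-⇒⁺ : ∀ X Y q → (∀ p → p ∈ cut X → p ·ᵘ q ∈ cut Y) → q ∈ cut (X ⇒ Y)
  ∈-⇒⁺ X Y q h = 𝕀.closed (X ⇒ Y) {q} λ t t<q →
    let t≤q = ℚ.<⇒≤ t<q
        (p , p′ , p∈X , X≤p′ , p′≤) =
          approximate X (difference t q t≤q) (difference-positive t q t≤q t<q)
    in 𝕀.down (X ⇒ Y) {t} {¬ᵘ p′ ⊕ᵘ p ·ᵘ q} (≤+difference⇒≤¬⊕· t q t≤q p p′ p′≤)
         (∈-⊕⁺ (¬ X) Y (¬ᵘ p′) (p ·ᵘ q) (∈-¬⁺ X (¬ᵘ p′) λ r r∈X → ¬ᵘ-anti r p′ (X≤p′ r r∈X)) (h p p∈X))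

-- Embedding the quotient by a maximal filter

module PavelkaProperties {c ℓ} (P : RawPavelka c ℓ) (isPavelka : IsPavelka P) where
  open RawPavelka P hiding (_≈_; _⊕_; ¬_)
  open RawMV rawMV using (_≈_; _⊕_; ¬_)
  open IsPavelka isPavelka using (isMV; const-⊕; const-¬) public
  open MVProperties isMV public

  const-1 : const 1ᵘ ≈ 1#
  const-1 = sym (const-¬ 0ᵤ 1ᵘ ≡.refl)

  const-⊕ᵘ : ∀ r s → const (r ⊕ᵘ s) ≈ (const r ⊕ const s)
  const-⊕ᵘ r s = sym (const-⊕ r s (r ⊕ᵘ s) (≡.sym (value-⊕ᵘ r s)))

  const-¬ᵘ : ∀ r → const (¬ᵘ r) ≈ (¬ const r)
  const-¬ᵘ r = sym (const-¬ r (¬ᵘ r) (≡.sym (value-¬ᵘ r)))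

  const-·ᵘ : ∀ r s → const (r ·ᵘ s) ≈ (const r · const s)
  const-·ᵘ r s = trans (reflexive (≡.cong const (·ᵘ≡¬⊕ r s))) (trans (const-¬ᵘ _) (¬-cong (trans (const-⊕ᵘ _ _)
    (⊕-cong (const-¬ᵘ r) (const-¬ᵘ s)))))

  const-mono : ∀ r s → value r ℚ.≤ value s → const r ≤ const s
  const-mono r s r≤s = trans (⊕-congʳ (sym (const-¬ᵘ r)))
    (trans (const-⊕ (¬ᵘ r) s 1ᵘ (¬ᵘ⊕ᵘ≡1 r s r≤s)) const-1)

  const-cong : ∀ r s → value r ≡ value s → const r ≈ const s
  const-cong r s r≡s = ≤-antisym (const-mono r s (ℚ.≤-reflexive r≡s))
                                 (const-mono s r (ℚ.≤-reflexive (≡.sym r≡s)))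

  module ConstantsModulo {a} (em : ExcludedMiddle a) {F : Pred Carrier a}
                         (isFilter : IsFilter rawMV F) where
    open FilterProperties isFilter

    -- If 0 ∉ F, a descent in steps of 1 - t finds constants q in F and p outside F with q · t ≤ p,
    -- although q · t ∈ F. F is any filter here, as `A-square` requires.
    const∈⇒0∈ : ∀ t → value t ℚ.< 1ℚ → const t ∈ F → 0# ∈ F
    const∈⇒0∈ t t<1 t∈F = decidable-stable em λ 0∉F →
      let (p , q , p∉F , q∈F , q≤) = descent
            (λ q → Sum.swap (toSum (em {const q ∈ F})))
            (∈-resp (sym const-1) 1-closed)
            (λ q q≤0 q∈F → 0∉F (upward (const-mono q 0ᵤ q≤0) q∈F))
            (¬ᵘ t) (¬ᵘ-positive t t<1)
      in p∉F (upward (const-mono (q ·ᵘ t) p (≤+¬ᵘ⇒·ᵘ≤ q p t q≤))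
           (∈-resp (sym (const-·ᵘ q t)) (·-closed q∈F t∈F)))

    const-⊑⁻ : IsProper rawMV F → ∀ r s → const r ⊑ const s → value r ℚ.≤ value s
    const-⊑⁻ 0∉F r s r⊑s = ℚ.≮⇒≥ λ s<r → 0∉F (const∈⇒0∈ (¬ᵘ r ⊕ᵘ s) (¬ᵘ⊕ᵘ<1 r s s<r)
      (∈-resp (sym (trans (const-⊕ᵘ _ _) (⊕-congʳ (const-¬ᵘ r)))) r⊑s))

module RealValues {ℓ} (em : ExcludedMiddle (suc ℓ)) (zorn : Zorn (suc ℓ) ℓ ℓ)
                  (P : RawPavelka ℓ ℓ) (isPavelka : IsPavelka P)
                  (F : Spec (RawPavelka.rawMV P)) where
  open RawPavelka P hiding (_≈_; _⊕_; ¬_)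
  open RawMV rawMV using (_≈_; _⊕_; ¬_)
  open PavelkaProperties P isPavelka
  open Spec F
  open FilterProperties isFilter
  open Maximal em zorn isMV using (em₀)
  open ConstantsModulo em₀ isFilter

  ⊑-total : ∀ x y → x ⊑ y ⊎ y ⊑ x
  ⊑-total = Maximal.⊑-total em zorn isMV F

  const-⊑⁺ : ∀ r s → value r ℚ.≤ value s → const r ⊑ const s
  const-⊑⁺ r s r≤s = ≤⇒⊑ (const-mono r s r≤s)

  const-reflect : ∀ r s → const r ⊑ const s → value r ℚ.≤ value s
  const-reflect = const-⊑⁻ proper

  -- A/F has no infinitesimals: the elements that exceed every constant below 1 modulo F form a
  -- proper filter containing F, which is F by maximality.
  archimedean-⊑ : ∀ {z} → (∀ c → value c ℚ.< 1ℚ → const c ⊑ z) → z ∈ filter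
  archimedean-⊑ = maximal almost-1 almost-1-isFilter almost-1-proper (λ y∈F _ _ → ∈⇒⊒ y∈F)
    where
    almost-1 : Pred Carrier ℓ
    almost-1 y = ∀ c → value c ℚ.< 1ℚ → const c ⊑ y

    almost-1-isFilter : IsFilter rawMV almost-1
    almost-1-isFilter = record
      { 1-closed = λ _ _ → ∈⇒⊒ 1-closed
      ; ·-closed = λ x∈ y∈ c c<1 →
          -- A square root of c that is still below 1.
          let h   = ¬ᵘ half (¬ᵘ c)
              h<1 = ¬ᵘ<1 (half (¬ᵘ c)) (half-positive (¬ᵘ c) (¬ᵘ-positive c c<1))
          in ⊑-trans (≤⇒⊑ (≈⇒≤ (trans (const-cong c (h ·ᵘ h) (midpoint-square c)) (const-·ᵘ h h))))
               (·-⊑-mono (x∈ h h<1) (y∈ h h<1))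
      ; upward   = λ x≤y x∈ c c<1 → ⊑-trans (x∈ c c<1) (≤⇒⊑ x≤y)
      }

    almost-1-proper : IsProper rawMV almost-1
    almost-1-proper 0∈ =
      let (m , 0<m , m<1) = <-denseᵘ {0ᵤ} {1ᵘ} (ℚ.positive⁻¹ 1ℚ)
      in ℚ.<-irrefl ≡.refl (ℚ.<-≤-trans 0<m (const-reflect m 0ᵤ (0∈ m m<1)))

  bracket : ∀ x δ → 0ℚ ℚ.< value δ →
            ∃₂ λ p q → const p ⊑ x × x ⊑ const q × value q ℚ.≤ value p ℚ.+ value δ
  bracket x = descent (λ q → ⊑-total (const q) x) (∈⇒⊒ (∈-resp (sym const-1) 1-closed))
    (λ q q≤0 → ≤⇒⊑ (≤-trans (const-mono q 0ᵤ q≤0) (≤-minimum x)))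

  -- If p ⊑ x ⊑ q with q - p ≤ 1 - c, then c · x ⊑ c · q ⊑ p ⊑ y; hence c ⊑ (x ⇒ y) for every c < 1.
  ⊑-by-constants : ∀ {x y} → (∀ t → const t ⊑ x → const t ⊑ y) → x ⊑ y
  ⊑-by-constants {x} {y} h = archimedean-⊑ λ c c<1 →
    let (p , q , p⊑x , x⊑q , q≤) = bracket x (¬ᵘ c) (¬ᵘ-positive c c<1)
    in ⊑-curry (⊑-trans (·-⊑-mono ⊑-refl x⊑q)
         (⊑-trans (≤⇒⊑ (≈⇒≤ (trans (·-comm _ _) (sym (const-·ᵘ q c)))))
           (⊑-trans (const-⊑⁺ (q ·ᵘ c) p (≤+¬ᵘ⇒·ᵘ≤ q p c q≤)) (h p p⊑x))))

  value-of : Carrier → 𝕀 ℓ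
  value-of x = record
    { cut    = λ r → const r ⊑ x
    ; down   = λ {p} {q} p≤q q⊑x → ⊑-trans (const-⊑⁺ p q p≤q) q⊑x
    ; closed = closed
    }
    where
    -- For q > 0 and c < 1, the product q · c is strictly below q and hence ⊑ x; so c ⊑ (q ⇒ x), and
    -- `archimedean-⊑` lets c tend to 1.
    closed : ∀ {q} → (∀ p → value p ℚ.< value q → const p ⊑ x) → const q ⊑ x
    closed {q} h = [
        (λ q≤0 → ⊑-trans (const-⊑⁺ q 0ᵤ q≤0) (≤⇒⊑ (≤-minimum x)))
      , (λ q≰0 → archimedean-⊑ λ c c<1 → ⊑-curry (⊑-trans
            (≤⇒⊑ (≈⇒≤ (trans (·-comm _ _) (sym (const-·ᵘ q c)))))
            (h (q ·ᵘ c) (·ᵘ< q c (ℚ.≰⇒> q≰0) c<1))))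
      ]′ (toSum (value q ℚ.≤? 0ℚ))

  -- x and y are bracketed with errors of half the gap t - p each.
  ⊕-values : ∀ x y p t → const t ⊑ x ⊕ y → value p ℚ.< value t →
             ∃₂ λ r s → const r ⊑ x × const s ⊑ y × value p ℚ.≤ value (r ⊕ᵘ s)
  ⊕-values x y p t t⊑ p<t =
    let p≤t = ℚ.<⇒≤ p<t
        δ   = half (difference p t p≤t)
        0<δ = half-positive (difference p t p≤t) (difference-positive p t p≤t p<t)
        (r , r′ , r⊑x , x⊑r′ , r′≤) = bracket x δ 0<δ
        (s , s′ , s⊑y , y⊑s′ , s′≤) = bracket y δ 0<δ
        t≤r′⊕s′ = const-reflect t (r′ ⊕ᵘ s′) (⊑-trans t⊑ (⊑-trans (⊕-⊑-mono x⊑r′ y⊑s′)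
                    (≤⇒⊑ (≈⇒≤ (sym (const-⊕ᵘ r′ s′))))))
    in r , s , r⊑x , s⊑y , ⊕ᵘ-bracket p t p≤t t≤r′⊕s′ r′≤ s′≤

  ·-values : ∀ x y s t → const t ⊑ x · y → value s ℚ.< value t →
             ∃₂ λ p q → const p ⊑ x × const q ⊑ y × value s ℚ.< value (p ·ᵘ q)
  ·-values x y s t t⊑ s<t =
    -- The gap from s to m pays for the bracketing errors, the gap from m to t for strictness.
    let (m , s<m , m<t) = <-denseᵘ {s} {t} s<t
        s≤m = ℚ.<⇒≤ s<m
        δ   = half (difference s m s≤m)
        0<δ = half-positive (difference s m s≤m) (difference-positive s m s≤m s<m)
        (p , p′ , p⊑x , x⊑p′ , p′≤) = bracket x δ 0<δ
        (q , q′ , q⊑y , y⊑q′ , q′≤) = bracket y δ 0<δ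
        t≤p′q′ = const-reflect t (p′ ·ᵘ q′) (⊑-trans t⊑ (⊑-trans (·-⊑-mono x⊑p′ y⊑q′)
                    (≤⇒⊑ (≈⇒≤ (sym (const-·ᵘ p′ q′))))))
    in p , q , p⊑x , q⊑y , ·ᵘ-bracket s m t s≤m m<t t≤p′q′ p′≤ q′≤

  private
    module 𝕀ₛ = RawPavelka (standard ℓ)
    open StandardProperties em₀

  value-of-isEmbedding : IsPavelkaEmbedding (P / F) (standard ℓ) value-of
  value-of-isEmbedding = record
    { isMVHomomorphism = record
      { cong   = λ (x⊑y , y⊑x) → (λ r⊑x → ⊑-trans r⊑x x⊑y) , (λ r⊑y → ⊑-trans r⊑y y⊑x)
      ; ⊕-homo = λ x y →
          (λ {t} t⊑ → 𝕀.closed (value-of x 𝕀ₛ.⊕ value-of y) {t} λ p p<t →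
            let (r , s , r⊑x , s⊑y , p≤) = ⊕-values x y p t t⊑ p<t
            in 𝕀.down (value-of x 𝕀ₛ.⊕ value-of y) {p} {r ⊕ᵘ s} p≤
                 (∈-⊕⁺ (value-of x) (value-of y) r s r⊑x s⊑y))
        , (λ {t} t∈ → 𝕀.closed (value-of (x ⊕ y)) {t} λ p p<t →
            let (r , s , r⊑x , s⊑y , p≤) = ∈-⊕⁻ (value-of x) (value-of y) p t t∈ p<t
            in ⊑-trans (const-⊑⁺ p (r ⊕ᵘ s) p≤)
                 (⊑-trans (≤⇒⊑ (≈⇒≤ (const-⊕ᵘ r s))) (⊕-⊑-mono r⊑x s⊑y)))
      ; ¬-homo = λ x →
          (λ {t} t⊑¬x → ∈-¬⁺ (value-of x) t λ p p⊑x → const-reflect t (¬ᵘ p)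
            (⊑-trans t⊑¬x (⊑-trans (¬-⊑-anti p⊑x) (≤⇒⊑ (≈⇒≤ (sym (const-¬ᵘ p)))))))
        , (λ {t} t∈ → 𝕀.closed (value-of (¬ x)) {t} λ p p<t → [
              id
            -- ¬ x ⊑ p would give ¬ p ⊑ x, hence t ≤ ¬ ¬ p = p.
            , (λ ¬x⊑p → contradiction
                (ℚ.<-≤-trans p<t (ℚ.≤-trans
                  (∈-¬⁻ (value-of x) (¬ᵘ p) t t∈ (⊑-trans (≤⇒⊑ (≈⇒≤ (const-¬ᵘ p)))
                    (⊑-trans (¬-⊑-anti ¬x⊑p) (≤⇒⊑ (≈⇒≤ (¬-involutive x))))))
                  (ℚ.≤-reflexive (¬ᵘ-involutive p))))
                (ℚ.<-irrefl ≡.refl))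
            ]′ (⊑-total (const p) (¬ x)))
      ; 0-homo = const-homo 0ᵤ
      }
    ; const-homo = const-homo
    ; injective  = λ (x⊆y , y⊆x) → ⊑-by-constants (λ t → x⊆y {t}) , ⊑-by-constants (λ t → y⊆x {t})
    }
    where
    const-homo : ∀ r → value-of (const r) 𝕀ₛ.≈ 𝕀ₛ.const r
    const-homo r = (λ {t} t⊑r → ∈-const⁺ t r (const-reflect t r t⊑r))
                 , (λ {t} t∈ → const-⊑⁺ t r (∈-const⁻ t r t∈))

-- Quantifiers and the relation R

module Quantifiers {ℓ} (𝐀 : MonadicPavelkaAlgebra ℓ) where
  open MonadicPavelkaAlgebra 𝐀 hiding (_≈_; _⊕_; ¬_)
  open RawMV rawMV using (_≈_; _⊕_; ¬_)
  open PavelkaProperties rawPavelka isPavelka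
  open IsMonadic isMonadic
  open IsClosureOperator isClosureOperator

  E-cong : ∀ {x y} → x ≈ y → E x ≈ E y
  E-cong x≈y = ≤-antisym (monotone (≈⇒≤ x≈y)) (monotone (≈⇒≤ (sym x≈y)))

  A-mono : ∀ {x y} → x ≤ y → A[ x ] ≤ A[ y ]
  A-mono x≤y = ¬-anti (monotone (¬-anti x≤y))

  A-¬ : ∀ x → A[ ¬ x ] ≈ (¬ E x)
  A-¬ x = ¬-cong (E-cong (¬-involutive x))

  -- E 0 = E (0 · 0) = 0 · E 0 = 0, by `E-const` at the constant 0.
  A-1 : A[ 1# ] ≈ 1#
  A-1 = ¬-cong (≤-antisym
    (≤-trans (monotone (≤-trans (≈⇒≤ (¬-involutive 0#)) (≤-minimum (0# · 0#))))
      (≤-trans (≈⇒≤ (sym (E-const 0ᵤ 0#))) (·-lowerˡ 0# (E 0#))))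
    (≤-minimum _))

  -- The dual of `E-const`, since ¬ (r ⇒ x) is r · ¬ x.
  A-const-⇒ : ∀ r x → A[ const r ⇒ x ] ≈ (const r ⇒ A[ x ])
  A-const-⇒ r x = trans
    (¬-cong (trans (E-cong (¬-cong (⊕-congˡ (sym (¬-involutive x))))) (sym (E-const r (¬ x)))))
    (¬-involutive _)

  Fixed : Pred Carrier ℓ
  Fixed x = E x ≈ x

  Fixed-resp : ∀ {x y} → x ≈ y → x ∈ Fixed → y ∈ Fixed
  Fixed-resp x≈y Ex≈x = trans (E-cong (sym x≈y)) (trans Ex≈x x≈y)

  Fixed-¬ : ∀ {x} → x ∈ Fixed → ¬ x ∈ Fixed
  Fixed-¬ {x} Ex≈x = Fixed-resp (¬-cong Ex≈x) (E-¬ x)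

  -- Holds for any closure operator; with closure under ¬ it yields joins of fixed points, and
  -- thereby `E-∨`.
  Fixed-∧ : ∀ {x y} → x ∈ Fixed → y ∈ Fixed → x ∧ y ∈ Fixed
  Fixed-∧ {x} {y} Ex≈x Ey≈y = ≤-antisym
    (∧-glb (≤-trans (monotone (∧-lowerˡ x y)) (≈⇒≤ Ex≈x))
           (≤-trans (monotone (∧-lowerʳ x y)) (≈⇒≤ Ey≈y)))
    (extensive _)

  ∨≈¬∧¬ : ∀ x y → ¬ (¬ x ∧ ¬ y) ≈ x ∨ y
  ∨≈¬∧¬ x y = trans (¬-involutive _)
    (⊕-cong (¬-cong (⊕-cong (¬-cong (¬-involutive x)) (¬-involutive y))) (¬-involutive y))

  Fixed-∨ : ∀ {x y} → x ∈ Fixed → y ∈ Fixed → x ∨ y ∈ Fixed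
  Fixed-∨ {x} {y} Ex≈x Ey≈y =
    Fixed-resp (∨≈¬∧¬ x y) (Fixed-¬ (Fixed-∧ (Fixed-¬ Ex≈x) (Fixed-¬ Ey≈y)))

  E-∨ : ∀ x y → E (x ∨ y) ≈ E x ∨ E y
  E-∨ x y = ≤-antisym
    (≤-trans (monotone (∨-mono (extensive x) (extensive y)))
      (≈⇒≤ (Fixed-∨ (idempotent x) (idempotent y))))
    (∨-lub (monotone (∨-upperˡ x y)) (monotone (∨-upperʳ x y)))

  A-∧ : ∀ x y → A[ x ] ∧ A[ y ] ≤ A[ x ∧ y ]
  A-∧ x y = ¬-anti (≤-trans (monotone (≈⇒≤ (¬-involutive _)))
    (≤-trans (≈⇒≤ (E-∨ (¬ x) (¬ y)))
      (∨-mono (≈⇒≤ (sym (¬-involutive _))) (≈⇒≤ (sym (¬-involutive _))))))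

  -- The De Morgan dual: subadditivity of E is (iii) for ¬ x and ¬ y.
  A-·⇒E-⊕-sub : (∀ x y → A[ x ] · A[ y ] ≤ A[ x · y ]) → ∀ x y → E (x ⊕ y) ≤ E x ⊕ E y
  A-·⇒E-⊕-sub A-· x y = ≤-respˡ (¬-involutive _) (≤-respʳ (¬-involutive _) (¬-anti
    (≤-respˡ
      (¬-cong (⊕-cong (trans (¬-cong (A-¬ x)) (¬-involutive _))
                      (trans (¬-cong (A-¬ y)) (¬-involutive _))))
      (≤-respʳ
        (¬-cong (E-cong (trans (¬-involutive _) (⊕-cong (¬-involutive x) (¬-involutive y)))))
        (A-· (¬ x) (¬ y))))))

  E-⊕-sub⇒A-· : (∀ x y → E (x ⊕ y) ≤ E x ⊕ E y) → ∀ x y → A[ x ] · A[ y ] ≤ A[ x · y ]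
  E-⊕-sub⇒A-· E-⊕-sub x y = ¬-anti (≤-trans (monotone (≈⇒≤ (¬-involutive _)))
    (≤-trans (E-⊕-sub (¬ x) (¬ y))
      (⊕-mono (≈⇒≤ (sym (¬-involutive _))) (≈⇒≤ (sym (¬-involutive _))))))

  -- E x ⊕ E y is a fixed point above x ⊕ y, so E is subadditive.
  original⇒A-· : IsOriginalMonadic rawPavelka E → ∀ x y → A[ x ] · A[ y ] ≤ A[ x · y ]
  original⇒A-· original = E-⊕-sub⇒A-· λ x y →
    ≤-trans (monotone (⊕-mono (extensive x) (extensive y)))
      (≈⇒≤ (IsOriginalMonadic.E-⊕ original x y))

  -- The set S of the overview; (iii) supplies its closure under products.
  A⁻¹-isFilter : (∀ x y → A[ x ] · A[ y ] ≤ A[ x · y ]) →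
                 ∀ {a} {F : Pred Carrier a} → IsFilter rawMV F → IsFilter rawMV (λ x → A[ x ] ∈ F)
  A⁻¹-isFilter A-· F-isFilter = record
    { 1-closed = F.∈-resp (sym A-1) F.1-closed
    ; ·-closed = λ Ax∈F Ay∈F → F.upward (A-· _ _) (F.·-closed Ax∈F Ay∈F)
    ; upward   = λ x≤y Ax∈F → F.upward (A-mono x≤y) Ax∈F
    }
    where module F = FilterProperties F-isFilter

-- Values at maximal filters and the equivalences

module Equivalence {ℓ} (em : ExcludedMiddle (suc ℓ)) (zorn : Zorn (suc ℓ) ℓ ℓ)
                   (𝐀 : MonadicPavelkaAlgebra ℓ) where
  open MonadicPavelkaAlgebra 𝐀 hiding (_≈_; _⊕_; ¬_)
  open RawMV rawMV using (_≈_; _⊕_; ¬_)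
  open PavelkaProperties rawPavelka isPavelka
  open Quantifiers 𝐀
  open Maximal em zorn isMV using (em₀; extend; separate)
  open StandardProperties em₀

  private
    module 𝕀ₛ = RawPavelka (standard ℓ)
    module At = RealValues em zorn rawPavelka isPavelka

  module _ (F : Spec rawMV) (i : Embedding F) where
    open Spec F
    open FilterProperties isFilter
    open IsPavelkaEmbedding (isEmbedding i)
    open IsMVHomomorphism isMVHomomorphism

    ∈⇒1∈eval : ∀ {x} → x ∈ filter → 1ᵘ ∈ cut (eval i x)
    ∈⇒1∈eval x∈F = proj₁ (cong (∈⇒⊒ x∈F , ∈⇒⊒ (∈-resp (sym const-1) 1-closed)))
      {1ᵘ} (proj₂ (const-homo 1ᵘ) {1ᵘ} (∈-const⁺ 1ᵘ 1ᵘ ℚ.≤-refl))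

    1∈eval⇒∈ : ∀ {x} → 1ᵘ ∈ cut (eval i x) → x ∈ filter
    1∈eval⇒∈ {x} 1∈ = 1⊑⇒∈ (⊑-trans (≤⇒⊑ (≈⇒≤ (sym const-1))) (proj₁ (injective {const 1ᵘ} {x}
      ( (λ {t} _ → 𝕀.down (eval i x) {t} {1ᵘ} (≤1 t) 1∈)
      , (λ {t} _ → proj₂ (const-homo 1ᵘ) {t} (∈-const⁺ t 1ᵘ (≤1 t)))))))

    ¬const-homo : ∀ r → eval i (¬ const r) 𝕀ₛ.≈ 𝕀ₛ.const (¬ᵘ r)
    ¬const-homo r =
        (λ {t} t∈ → proj₁ (const-homo (¬ᵘ r)) {t} (proj₁ ¬const≈ {t} t∈))
      , (λ {t} t∈ → proj₂ ¬const≈ {t} (proj₂ (const-homo (¬ᵘ r)) {t} t∈))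
      where
      ¬const≈ : eval i (¬ const r) 𝕀ₛ.≈ eval i (const (¬ᵘ r))
      ¬const≈ = cong (≤⇒⊑ (≈⇒≤ (sym (const-¬ᵘ r))) , ≤⇒⊑ (≈⇒≤ (const-¬ᵘ r)))

    -- For an arbitrary embedding, r ⇒ x has value 1. Given p < r, the smaller number 1 - (r - p) is
    -- at most u ⊕ s with u ≤ 1 - r and s ≤ x/F, so p ≤ s.
    ⊑⇒∈eval : ∀ r x → const r ⊑ x → r ∈ cut (eval i x)
    ⊑⇒∈eval r x r⊑x = 𝕀.closed (eval i x) {r} λ p p<r →
      let p≤r = ℚ.<⇒≤ p<r
          d   = difference p r p≤r
          (u , s , u∈ , s∈ , ¬d≤) = ∈-⊕⁻ (eval i (¬ const r)) (eval i x) (¬ᵘ d) 1ᵘ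
            (proj₁ (⊕-homo (¬ const r) x) {1ᵘ} (∈⇒1∈eval r⊑x))
            (¬ᵘ<1 d (difference-positive p r p≤r p<r))
      in 𝕀.down (eval i x) {p} {s} (¬difference≤¬⊕ p r p≤r u s
           (∈-const⁻ u (¬ᵘ r) (proj₁ (¬const-homo r) {u} u∈)) ¬d≤) s∈

    -- ¬ r ⊕ r = 1 is below the value of r ⇒ x, and only members of F have value 1.
    ∈eval⇒⊑ : ∀ r x → r ∈ cut (eval i x) → const r ⊑ x
    ∈eval⇒⊑ r x r∈ = 1∈eval⇒∈ (proj₂ (⊕-homo (¬ const r) x) {1ᵘ}
      (𝕀.down (eval i (¬ const r) 𝕀ₛ.⊕ eval i x) {1ᵘ} {¬ᵘ r ⊕ᵘ r}
        (ℚ.≤-reflexive (≡.sym (≡.trans (value-⊕ᵘ (¬ᵘ r) r) (¬ᵘ⊕ᵘ≡1 r r ℚ.≤-refl))))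
        (∈-⊕⁺ (eval i (¬ const r)) (eval i x) (¬ᵘ r) r
          (proj₂ (¬const-homo r) {¬ᵘ r} (∈-const⁺ (¬ᵘ r) (¬ᵘ r) ℚ.≤-refl)) r∈)))

  embedding : ∀ F → Embedding F
  embedding F = record { eval = At.value-of F ; isEmbedding = At.value-of-isEmbedding F }

  module _ {F F′ : Spec rawMV} (i : Embedding F) (i′ : Embedding F′) where
    private
      module F  = FilterProperties (Spec.isFilter F)
      module F′ = FilterProperties (Spec.isFilter F′)

    -- The case p = 1 of residuation.
    ∈R⁻ : ∀ q → q ∈ cut (R i i′) → ∀ x → A[ x ] ∈ Spec.filter F′ → const q F.⊑ x
    ∈R⁻ q q∈R x Ax∈F′ = F.⊑-trans (F.≤⇒⊑ (const-mono q (1ᵘ ·ᵘ q) (≤1·ᵘ q)))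
      (∈eval⇒⊑ F i (1ᵘ ·ᵘ q) x
        (∈-⇒⁻ (eval i′ A[ x ]) (eval i x) 1ᵘ q (q∈R x) (∈⇒1∈eval F′ i′ Ax∈F′)))

    -- Whenever p ≤ ∀ x/F′, the element p ⇒ x is in S because ∀ commutes with p ⇒ _; the hypothesis
    -- for it gives p · q ⊑ x.
    ∈R⁺ : ∀ q → (∀ x → A[ x ] ∈ Spec.filter F′ → const q F.⊑ x) → q ∈ cut (R i i′)
    ∈R⁺ q h x = ∈-⇒⁺ (eval i′ A[ x ]) (eval i x) q λ p p∈ → ⊑⇒∈eval F i (p ·ᵘ q) x
      (F.⊑-trans (F.≤⇒⊑ (≈⇒≤ (trans (const-·ᵘ p q) (·-comm _ _))))
        (F.⊑-uncurry (h (const p ⇒ x)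
          (F′.∈-resp (sym (A-const-⇒ p x)) (∈eval⇒⊑ F′ i′ p A[ x ] p∈)))))

  ∈1 : ∀ q → q ∈ cut 𝕀ₛ.1#
  ∈1 q = ∈-¬⁺ 𝕀ₛ.0# q λ p p∈ → ℚ.≤-trans (≤1 q)
    (ℚ.≤-trans (ℚ.≤-reflexive (≡.sym (value-¬ᵘ 0ᵤ))) (¬ᵘ-anti p 0ᵤ (∈-const⁻ p 0ᵤ p∈)))

  A-·⇒boolean : (∀ x y → A[ x ] · A[ y ] ≤ A[ x · y ]) → IsBooleanValued
  A-·⇒boolean A-· F F′ i i′ with em₀ {∃ λ x → A[ x ] ∈ Spec.filter F′ × x ∉ Spec.filter F}
  ... | no  S⊈F = inj₂
    ( (λ {q} _ → ∈1 q)
    , (λ {q} _ → ∈R⁺ i i′ q λ x Ax∈F′ →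
        F.∈⇒⊒ (decidable-stable em₀ λ x∉F → S⊈F (x , Ax∈F′ , x∉F))))
    where module F = FilterProperties (Spec.isFilter F)
  ... | yes (x , Ax∈F′ , x∉F) with em₀ {∃ λ s → A[ s ] ∈ Spec.filter F′ × (s ⇒ 0#) ∈ Spec.filter F}
  -- If S and F generated a proper filter, it would be F by maximality, yet it contains x.
  ...   | no  proper = contradiction
    (Spec.maximal F _ (F.above-isFilter (A⁻¹-isFilter A-· (Spec.isFilter F′))) proper
      (λ y∈F → 1# , F′.∈-resp (sym A-1) F′.1-closed , F.∈⇒⊒ y∈F)
      (x , Ax∈F′ , F.⊑-refl))
    x∉F
    where module F = FilterProperties (Spec.isFilter F)
          module F′ = FilterProperties (Spec.isFilter F′)
  -- q ⊑ s ⊑ 0 for every q ≤ R(F,F′), which forces R(F,F′) = 0.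
  ...   | yes (s , As∈F′ , s⊑0) = inj₁
    ( (λ {q} q∈R → ∈-const⁺ q 0ᵤ (At.const-reflect F q 0ᵤ (F.⊑-trans (∈R⁻ i i′ q q∈R s As∈F′) s⊑0)))
    , (λ {q} q∈0 → ∈R⁺ i i′ q λ y _ →
        F.⊑-trans (At.const-⊑⁺ F q 0ᵤ (∈-const⁻ q 0ᵤ q∈0)) (F.≤⇒⊑ (≤-minimum y))))
    where module F = FilterProperties (Spec.isFilter F)

  -- Consequences of semisimplicity

  module _ (semisimple : Semisimple rawMV) where

    -- In a semisimple algebra the maximal filters intersect in 1, by `separate`.
    ≤-by-maximal : ∀ {x y} → (∀ (F : Spec rawMV) → (x ⇒ y) ∈ Spec.filter F) → x ≤ y
    ≤-by-maximal h = decidable-stable em₀ λ x≰y →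
      let (F , ∉F) = separate semisimple x≰y in ∉F (h F)

    module _ (boolean : IsBooleanValued) (F′ : Spec rawMV) (x y : Carrier)
             (s : Unitℚ) (s<1 : value s ℚ.< 1ℚ) where
      private
        module F′ = FilterProperties (Spec.isFilter F′)

      -- It contains (b ⇒ z) ⇒ s whenever A[ b ] ∈ F′, by prelinearity.
      witness : Carrier → Pred Carrier ℓ
      witness z w = ∃ λ b → A[ b ] ∈ Spec.filter F′ × w ∨ (const s ⇒ (b ⇒ z)) ≈ 1#

      witness-isFilter : ∀ z → IsFilter rawMV (witness z)
      witness-isFilter z = record
        { 1-closed = 1# , F′.∈-resp (sym A-1) F′.1-closed , 1≤⇒≈1 (∨-upperˡ _ _)
        ; ·-closed = λ {u} {v} (b , Ab∈F′ , u∨) (c , Ac∈F′ , v∨) →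
            -- A meet rather than a product: `A-∧` is available, while compatibility of ∀ with
            -- products is the goal.
            b ∧ c
          , F′.upward (≤-trans (∧-glb (·-lowerˡ _ _) (·-lowerʳ _ _)) (A-∧ b c))
              (F′.·-closed Ab∈F′ Ac∈F′)
          , 1≤⇒≈1 (≤-trans
              (≈⇒≤ (sym (trans (¬-cong (⊕-cong (¬-cong u∨) (¬-cong v∨))) (·-identityʳ 1#))))
              (≤-trans
                (·-mono (∨-mono ≤-refl (⇒-mono ≤-refl (⇒-mono (∧-lowerˡ b c) ≤-refl)))
                        (∨-mono ≤-refl (⇒-mono ≤-refl (⇒-mono (∧-lowerʳ b c) ≤-refl))))
                (∨-·-distrib u v _)))
        ; upward   = λ u≤v (b , Ab∈F′ , u∨) →
            b , Ab∈F′ , 1≤⇒≈1 (≤-respˡ u∨ (∨-mono u≤v ≤-refl))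
        }

      -- If 0 belongs to it, then s ≤ (b ⇒ z), so b ≤ (s ⇒ z) and A[ b ] ≤ (s ⇒ A[ z ]), whence s ⊑
      -- A[ z ].
      witness-proper : ∀ z → Not (const s F′.⊑ A[ z ]) → IsProper rawMV (witness z)
      witness-proper z s⋢Az (b , Ab∈F′ , 0∨) = s⋢Az (F′.∈-resp (A-const-⇒ s z)
        (F′.upward (A-mono (·≤⇒≤⇒ (≤-respˡ (·-comm _ _) (≤⇒-⇒·≤ s≤b⇒z)))) Ab∈F′))
        where
        s≤b⇒z : const s ≤ (b ⇒ z)
        s≤b⇒z = trans (sym (≤⇒∨≈ (≤-minimum _))) 0∨

      no-gap : Not (const s F′.⊑ A[ x · y ]) → ∀ p q → value s ℚ.< value (p ·ᵘ q) →
               const p F′.⊑ A[ x ] → Not (const q F′.⊑ A[ y ])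
      no-gap s⋢ p q s<pq p⊑Ax q⊑Ay =
        [ (λ R≈0 → ℚ.<-irrefl ≡.refl (ℚ.<-≤-trans (¬ᵘ-positive s s<1)
            (∈-const⁻ (¬ᵘ s) 0ᵤ (proj₁ R≈0 {¬ᵘ s} ¬s∈R))))
        , (λ R≈1 →
            let F′⇒F : ∀ b → A[ b ] ∈ Spec.filter F′ → b ∈ Spec.filter F
                F′⇒F b Ab∈F′ = F.1⊑⇒∈ (F.⊑-trans (F.≤⇒⊑ (≈⇒≤ (sym const-1)))
                  (∈R⁻ i i′ 1ᵘ (proj₂ R≈1 {1ᵘ} (∈1 1ᵘ)) b Ab∈F′))
                p⊑x = F′⇒F (const p ⇒ x) (F′.∈-resp (sym (A-const-⇒ p x)) p⊑Ax)
                q⊑y = F′⇒F (const q ⇒ y) (F′.∈-resp (sym (A-const-⇒ q y)) q⊑Ay)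
            in ℚ.<-irrefl ≡.refl (ℚ.<-≤-trans s<pq (At.const-reflect F (p ·ᵘ q) s
                 (F.⊑-trans (F.≤⇒⊑ (≈⇒≤ (const-·ᵘ p q)))
                   (F.⊑-trans (F.·-⊑-mono p⊑x q⊑y) xy⊑s)))))
        ]′ (boolean F F′ i i′)
        where
        extension = extend (witness-isFilter (x · y)) (witness-proper (x · y) s⋢)
        F = proj₁ extension
        module F = FilterProperties (Spec.isFilter F)
        i  = embedding F
        i′ = embedding F′

        b⇒xy⊑s : ∀ b → A[ b ] ∈ Spec.filter F′ → (b ⇒ x · y) F.⊑ const s
        b⇒xy⊑s b Ab∈F′ = proj₂ extension (b , Ab∈F′ , prelinearity _ _)

        -- The case b = 1.
        xy⊑s : x · y F.⊑ const s
        xy⊑s = F.⊑-trans (F.≤⇒⊑ (≈⇒≤ (sym (⇒-identityˡ _))))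
          (b⇒xy⊑s 1# (F′.∈-resp (sym A-1) F′.1-closed))

        -- ¬ b ≤ (b ⇒ x · y) ⊑ s, so ¬ s ⊑ b for every b in S.
        ¬s∈R : ¬ᵘ s ∈ cut (R i i′)
        ¬s∈R = ∈R⁺ i i′ (¬ᵘ s) λ b Ab∈F′ →
          F.⊑-trans (F.≤⇒⊑ (≈⇒≤ (const-¬ᵘ s)))
            (F.⊑-trans (F.¬-⊑-anti (F.⊑-trans (F.≤⇒⊑ (⊕-upperˡ (¬ b) (x · y))) (b⇒xy⊑s b Ab∈F′)))
              (F.≤⇒⊑ (≈⇒≤ (¬-involutive b))))

    boolean⇒A-· : IsBooleanValued → ∀ x y → A[ x ] · A[ y ] ≤ A[ x · y ]
    boolean⇒A-· boolean x y = ≤-by-maximal λ F′ →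
      -- By `closed` it suffices to treat s < t; the slack leaves room for p and q with s < p · q.
      At.⊑-by-constants F′ λ t t⊑ → 𝕀.closed (At.value-of F′ A[ x · y ]) {t} λ s s<t →
        decidable-stable em₀ λ s⋢ →
          let (p , q , p⊑Ax , q⊑Ay , s<pq) = At.·-values F′ A[ x ] A[ y ] s t t⊑ s<t
          in no-gap boolean F′ x y s (ℚ.<-≤-trans s<t (≤1 t)) s⋢ p q s<pq p⊑Ax q⊑Ay

    -- In [0,1] with h ≤ ½, both sides are 1 if h ≤ x, and otherwise
    -- 1 - 2(h - x) ≤ 1 - (h - x).
    double-⇒ : ∀ h x → h ≤ ¬ h → (h ⊕ h) ⇒ (x ⊕ x) ≤ h ⇒ x
    double-⇒ h x h≤¬h = ≤-by-maximal λ F →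
      let open FilterProperties (Spec.isFilter F) in
      [ ∈⇒⊒
      , (λ x⊑h → ⊑-trans (≤⇒⊑ (≈⇒≤ (sym (⊕-assoc _ x x))))
          (⊕-⊑-mono (⊑-trans (⊕-⊑-mono ⊑-refl x⊑h)
            (≤⇒⊑ (≤-respˡ (⊕-congʳ (¬-cong (⊕-congʳ (¬-involutive h))))
              (∨-lub {¬ h} {h} ≤-refl h≤¬h)))) ⊑-refl))
      ]′ (At.⊑-total F h x)

    -- In [0,1], if x ≤ ½ then x · x = 0 and the left side is ¬ (h · h); if
    -- ½ ≤ x ≤ h, it is 1 - 2(h - x) ≤ 1 - (h - x).
    square-⇒ : ∀ h x → (h · h) ⇒ (x · x) ≤ (h ⇒ x) ∨ ¬ (h · h)
    square-⇒ h x = ≤-by-maximal λ F →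
      let open FilterProperties (Spec.isFilter F) in
      [ (λ h⊑x → ⊑-trans (∈⇒⊒ h⊑x) (≤⇒⊑ (∨-upperˡ _ _)))
      , (λ x⊑h →
        [ (λ x⊑¬x → ⊑-trans
            (⊕-⊑-mono ⊑-refl (⊑-uncurry (⊑-trans x⊑¬x (≤⇒⊑ (⊕-upperˡ (¬ x) 0#)))))
            (≤⇒⊑ (≤-trans (≈⇒≤ (trans (⊕-comm _ _) (⊕-identityˡ _))) (∨-upperʳ _ _))))
        , (λ ¬x⊑x → ⊑-trans
            (≤⇒⊑ (≈⇒≤ (trans (⊕-congʳ (¬-involutive _)) (⊕-assoc _ _ _))))
            (⊑-trans
              (⊕-⊑-mono ⊑-refl (⊑-trans (⊕-⊑-mono (¬-⊑-anti x⊑h) ⊑-refl)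
                (⊑-trans (≤⇒⊑ (≈⇒≤ (trans (⊕-comm _ _) (∨-comm x (¬ x)))))
                  (⊑-trans (⇒-⊑-mono (∈⇒⊒ ¬x⊑x) ⊑-refl) (≤⇒⊑ (≈⇒≤ (⇒-identityˡ x)))))))
              (≤⇒⊑ (∨-upperˡ _ _))))
        ]′ (At.⊑-total F x (¬ x)))
      ]′ (At.⊑-total F h x)

    A-double : ∀ x → A[ x ⊕ x ] ≤ A[ x ] ⊕ A[ x ]
    A-double x = ≤-by-maximal λ F → At.⊑-by-constants F λ t t⊑ →
      let open FilterProperties (Spec.isFilter F)
          -- t/2 has sum t with itself and is at most its complement, as `double-⇒` demands.
          h    = half t
          t≈hh = trans (const-cong t (h ⊕ᵘ h) (≡.sym (half⊕half t))) (const-⊕ᵘ h h)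
          h≤¬h = ≤-trans (const-mono h (¬ᵘ h) (half≤¬half t)) (≈⇒≤ (const-¬ᵘ h))
          h⊑   = ∈-resp (A-const-⇒ h x) (upward
                   (A-mono (≤-trans (⇒-mono (≈⇒≤ (sym t≈hh)) ≤-refl) (double-⇒ (const h) x h≤¬h)))
                   (∈-resp (sym (A-const-⇒ t (x ⊕ x))) t⊑))
      in ⊑-trans (≤⇒⊑ (≈⇒≤ t≈hh)) (⊕-⊑-mono h⊑ h⊑)

    A-square : (∀ x y → A[ x ] · A[ y ] ≤ A[ x · y ]) → ∀ x → A[ x · x ] ≤ A[ x ] · A[ x ]
    A-square A-· x = ≤-by-maximal λ F → At.⊑-by-constants F λ t t⊑ →
      let open FilterProperties (Spec.isFilter F)
          S-isFilter = A⁻¹-isFilter A-· (Spec.isFilter F)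
          module S = FilterProperties S-isFilter
          -- The square root (1 + t)/2 of t.
          h    = ¬ᵘ half (¬ᵘ t)
          t≈hh = trans (const-cong t (h ·ᵘ h) (midpoint-square t)) (const-·ᵘ h h)
          ¬t∨∈S : const (¬ᵘ t) ∨ (const h ⇒ x) ∈ (λ z → A[ z ] ∈ Spec.filter F)
          ¬t∨∈S = S.upward
            (≤-trans (⇒-mono (≈⇒≤ (sym t≈hh)) ≤-refl)
              (≤-trans (square-⇒ (const h) x)
                (≤-trans (≈⇒≤ (∨-comm _ _))
                  (∨-mono (≈⇒≤ (trans (¬-cong (sym t≈hh)) (sym (const-¬ᵘ t)))) ≤-refl))))
            (∈-resp (sym (A-const-⇒ t (x · x))) t⊑)
      in [ (λ t≤0 → ⊑-trans (At.const-⊑⁺ F t 0ᵤ t≤0) (≤⇒⊑ (≤-minimum _)))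
         , (λ t≰0 →
             -- The z with z ∨ (h ⇒ x) ∈ S form a filter that contains the constant 1 - t < 1, hence
             -- contains 0; so h ⇒ x ∈ S.
             let h⊑ = ∈-resp (A-const-⇒ h x) (S.∈-resp (≤⇒∨≈ (≤-minimum _))
                        (ConstantsModulo.const∈⇒0∈ em₀ (S.∨∈-isFilter (const h ⇒ x)) (¬ᵘ t)
                          (¬ᵘ<1 t (ℚ.≰⇒> t≰0)) ¬t∨∈S))
             in ⊑-trans (≤⇒⊑ (≈⇒≤ t≈hh)) (·-⊑-mono h⊑ h⊑))
         ]′ (toSum (value t ℚ.≤? 0ℚ))

    A-·⇒original : (∀ x y → A[ x ] · A[ y ] ≤ A[ x · y ]) → IsOriginalMonadic rawPavelka E
    A-·⇒original A-· = record
      { extensive = extensive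
      ; E-∨       = E-∨
      ; E-¬       = E-¬
      ; E-⊕       = E-⊕
      -- The lower bound for `E-double` is `A-square` at ¬ x; that for `E-square` is `A-double` at ¬
      -- x.
      ; E-double  = λ x → ≤-antisym (E-⊕-sub x x)
          (≤-respˡ (¬-involutive _) (≤-respʳ (¬-involutive _) (¬-anti
            (≤-respˡ (¬-cong (E-cong (trans (¬-involutive _)
                       (⊕-cong (¬-involutive x) (¬-involutive x)))))
              (≤-respʳ (¬-cong (⊕-cong (trans (¬-cong (A-¬ x)) (¬-involutive _))
                                       (trans (¬-cong (A-¬ x)) (¬-involutive _))))
                (A-square A-· (¬ x)))))))
      ; E-square  = λ x → ≤-antisym
          (≤-trans (monotone (·-mono (extensive x) (extensive x)))
            -- E x · E x is the negation of ¬ E x ⊕ ¬ E x, a sum of fixed points and so fixed.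
            (≈⇒≤ (Fixed-¬ (Fixed-resp (⊕-cong (E-¬ x) (E-¬ x)) (E-⊕ (¬ E x) (¬ E x))))))
          (≤-respʳ (¬-involutive _) (¬-anti
            (≤-respʳ (⊕-cong (A-¬ x) (A-¬ x)) (A-double (¬ x)))))
      -- The monadic axiom r · E x = E (r · x) at x = 1, where E 1 = 1 by extensivity.
      ; E-const   = λ r → trans (E-cong (sym (·-identityʳ (const r))))
          (trans (sym (E-const r 1#)) (trans (¬-cong (⊕-congˡ (¬-cong (1≤⇒≈1 (extensive 1#)))))
            (·-identityʳ (const r))))
      }
      where
      open IsMonadic isMonadic
      open IsClosureOperator isClosureOperator
      E-⊕-sub = A-·⇒E-⊕-sub A-·

      E-⊕ : ∀ x y → E (E x ⊕ E y) ≈ E x ⊕ E y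
      E-⊕ x y = ≤-antisym
        (≤-trans (E-⊕-sub (E x) (E y)) (⊕-mono (≈⇒≤ (idempotent x)) (≈⇒≤ (idempotent y))))
        (extensive _)

theorem16 : ∀ {ℓ} → ExcludedMiddle (suc ℓ) → Zorn (suc ℓ) ℓ ℓ →
    (𝐀 : MonadicPavelkaAlgebra ℓ) → let open MonadicPavelkaAlgebra 𝐀 in
    Semisimple rawMV →
    (IsBooleanValued ⇔ IsOriginalMonadic rawPavelka E) ×
    (IsOriginalMonadic rawPavelka E ⇔ (∀ x y → (A[ x ] · A[ y ]) ≤ A[ x · y ]))
theorem16 em zorn 𝐀 semisimple =
    mk⇔ (λ boolean → A-·⇒original semisimple (boolean⇒A-· semisimple boolean))
        (λ original → A-·⇒boolean (original⇒A-· original))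
  , mk⇔ original⇒A-· (A-·⇒original semisimple)
  where
  open Quantifiers 𝐀
  open Equivalence em zorn 𝐀
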